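{- Let $a,m$ be integers with $3\le a\le m-1$, let $\gamma=a\,2\,3\cdots(a-1)\,(a+1)\cdots m\,1\in\mathcal S_m$ (that is, $a$, followed by the elements of $\{2,\dots,m\}\setminus\{a\}$ in increasing order, followed by $1$), and let $B=B(t,x)=\sum_{n\ge 0}t^n\sum_{\sigma\in\mathcal S_n(132)}x^{\gamma\text{ -mch}(\sigma)}$. Then $$B=\frac{tB^{m-a+2}+t^{a-2}(x-1)(B-1-tB)(B-1)^{m-a}}{(B-1)B^{m-a-1}}.$$
   Context: $\mathcal S_n$ is the set of permutations of $\{1,\dots,n\}$ in one-line notation ($\mathcal S_0$ contains only the empty permutation, on which all statistics are $0$). For a word $w$ of distinct integers, $\mathrm{red}(w)$ replaces the $i$-th smallest letter by $i$. $\sigma\in\mathcal S_n$ avoids $\lambda\in\mathcal S_k$ (classical avoidance) if no (not necessarily contiguous) subsequence $\sigma_{i_1}\cdots\sigma_{i_k}$, $i_1<\dots<i_k$, has reduction $\lambda$; $\mathcal S_n(\lambda)$ is the set of such $\sigma$. $\gamma\text{ -mch}(\sigma)$ is the number of $i$ with $\mathrm{red}(\sigma_i\sigma_{i+1}\cdots\sigma_{i+k-1})=\gamma$ for $\gamma\in\mathcal S_k$. The identity is in the fraction field of $\mathbb Q[x][[t]]$ (note $B\ne 1$). -}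

module Defs where

open import Algebra.Bundles.Raw using (RawRing)
open import Data.List.Base
  using (List; []; _∷_; _++_; [_]; map; filter; length; take; tails; foldr; applyUpTo; cartesianProductWith)
open import Data.List.Properties using (≡-dec)
open import Data.List.Relation.Binary.Sublist.Propositional using (_⊆_; []; _∷_; _∷ʳ_)
open import Data.Fin.Base using (toℕ)
open import Data.Nat.Base as ℕ using (ℕ; zero; suc; _∸_)
open import Data.Nat.Properties using (_≤?_; _≟_)
open import Data.List.Relation.Unary.Unique.DecPropositional _≟_ using (unique?)
import Data.Rational.Base as ℚ
open import Level using (Level; _⊔_)
open import Relation.Binary.PropositionalEquality using (_≡_; _≢_; refl)
open import Relation.Nullary.Decidable using (Dec; yes; no; ¬?)
open import Relation.Unary using (Pred; Decidable)
import Algebra.Definitions.RawSemiring as RawSemiringDefs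
import Algebra.Definitions.RawMonoid as RawMonoidDefs

private
  variable
    c ℓ : Level

Word : Set
Word = List ℕ

-- The integers lo, lo + 1, …, hi (empty if hi < lo).
interval : ℕ → ℕ → Word
interval lo hi = applyUpTo (λ i → lo ℕ.+ i) (suc hi ∸ lo)

words : Word → ℕ → List Word
words alphabet zero    = [ [] ]
words alphabet (suc k) = cartesianProductWith _∷_ alphabet (words alphabet k)

-- One-line notations of the permutations of {1,…,n}: the words of length n
-- over {1,…,n} without repeated letters, each listed exactly once.
𝒮 : ℕ → List Word
𝒮 n = filter unique? (words (interval 1 n) n)

-- A letter of a word of distinct letters is the i-th smallest exactly when
-- i letters of the word are less than or equal to it.
red : Word → Word
red w = map (λ x → length (filter (λ y → y ≤? x) w)) w

Avoids : Word → Word → Set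
Avoids pat σ = ∀ {τ} → τ ⊆ σ → red τ ≢ pat

private
  allSublists? : ∀ {p} {P : Pred Word p} → Decidable P →
                 (σ : Word) → Dec (∀ {τ} → τ ⊆ σ → P τ)
  allSublists? P? [] with P? []
  ... | yes p = yes λ { [] → p }
  ... | no ¬p = no λ all → ¬p (all [])
  allSublists? P? (x ∷ σ) with allSublists? P? σ | allSublists? (λ τ → P? (x ∷ τ)) σ
  ... | yes p | yes q = yes λ { (_ ∷ʳ s) → p s ; (refl ∷ s) → q s }
  ... | no ¬p | _     = no λ all → ¬p (λ s → all (x ∷ʳ s))
  ... | yes _ | no ¬q = no λ all → ¬q (λ s → all (refl ∷ s))

avoids? : (pat σ : Word) → Dec (Avoids pat σ)
avoids? pat = allSublists? (λ τ → ¬? (≡-dec _≟_ (red τ) pat))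

𝒮-avoiding : Word → ℕ → List Word
𝒮-avoiding pat n = filter (avoids? pat) (𝒮 n)

-- Each starting position of σ gives a suffix.  A suffix shorter than pat
-- contributes nothing, since red preserves length.
mch : Word → Word → ℕ
mch pat σ = length (filter (λ w → ≡-dec _≟_ (red (take (length pat) w)) pat) (tails σ))

-- a 2 3 ⋯ (a-1) (a+1) ⋯ m 1
γ : (a m : ℕ) → Word
γ a m = a ∷ interval 2 (a ∸ 1) ++ interval (suc a) m ++ [ 1 ]

-- Polynomials: coefficient lists, constant term first, compared
-- coefficientwise so that trailing zeros are irrelevant.
module Polynomial (R : RawRing c ℓ) where
  private module R = RawRing R

  Poly : Set c
  Poly = List R.Carrier

  coeff : Poly → ℕ → R.Carrier
  coeff []      _       = R.0#
  coeff (a ∷ p) zero    = a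
  coeff (a ∷ p) (suc k) = coeff p k

  infixl 6 _+_
  infixl 7 _*_

  _+_ : Poly → Poly → Poly
  []      + q       = q
  (a ∷ p) + []      = a ∷ p
  (a ∷ p) + (b ∷ q) = (a R.+ b) ∷ (p + q)

  _*_ : Poly → Poly → Poly
  []      * q = []
  (a ∷ p) * q = map (a R.*_) q + (R.0# ∷ p * q)

  indeterminate : Poly
  indeterminate = R.0# ∷ R.1# ∷ []

  rawRing : RawRing c ℓ
  rawRing = record
    { Carrier = Poly
    ; _≈_     = λ p q → ∀ k → coeff p k R.≈ coeff q k
    ; _+_     = _+_
    ; _*_     = _*_
    ; -_      = map R.-_
    ; 0#      = []
    ; 1#      = [ R.1# ]
    }

module PowerSeries (R : RawRing c ℓ) where
  private module R = RawRing R
  open RawMonoidDefs R.+-rawMonoid using (sum)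

  Series : Set c
  Series = ℕ → R.Carrier

  constant : R.Carrier → Series
  constant a zero    = a
  constant a (suc n) = R.0#

  indeterminate : Series
  indeterminate 1 = R.1#
  indeterminate _ = R.0#

  rawRing : RawRing c ℓ
  rawRing = record
    { Carrier = Series
    ; _≈_     = λ f g → ∀ n → f n R.≈ g n
    ; _+_     = λ f g n → f n R.+ g n
    ; _*_     = λ f g n → sum {suc n} (λ i → f (toℕ i) R.* g (n ∸ toℕ i))
    ; -_      = λ f n → R.- f n
    ; 0#      = λ _ → R.0#
    ; 1#      = constant R.1#
    }

-- Fractions of an integral domain: r / s ⟨ s≉0 ⟩ is the quotient of r by s in
-- the fraction field, and _≃_ is equality there.
module Fractions (R : RawRing c ℓ) where
  open RawRing R

  infix 5 _/_⟨_⟩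
  record Fraction : Set (c ⊔ ℓ) where
    constructor _/_⟨_⟩
    field
      numerator     : Carrier
      denominator   : Carrier
      denominator≉0 : denominator ≉ 0#

  open Fraction

  infix 4 _≃_
  _≃_ : Fraction → Fraction → Set ℓ
  p ≃ q = numerator p * denominator q ≈ numerator q * denominator p

  embed : 1# ≉ 0# → Carrier → Fraction
  embed 1≉0 r = r / 1# ⟨ 1≉0 ⟩

ℚ[x] : RawRing _ _
ℚ[x] = Polynomial.rawRing ℚ.+-*-rawRing

ℚ[x][[t]] : RawRing _ _
ℚ[x][[t]] = PowerSeries.rawRing ℚ[x]

open RawRing ℚ[x][[t]] public
open RawSemiringDefs rawSemiring public using (_^_)
open Fractions ℚ[x][[t]] public

infixl 6 _-_
_-_ : Carrier → Carrier → Carrier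
f - g = f + (- g)

x : Carrier
x = PowerSeries.constant ℚ[x] (Polynomial.indeterminate ℚ.+-*-rawRing)

t : Carrier
t = PowerSeries.indeterminate ℚ[x]

ι : Carrier → Fraction
ι = embed 1≉0
  where
  1≉0 : 1# ≉ 0#
  1≉0 1≈0 with 1≈0 0 0
  ... | ()

-- Σ_{n ≥ 0} tⁿ Σ_{σ ∈ 𝒮ₙ(132)} x^{pat-mch(σ)}, given by its coefficients of tⁿ.
B : Word → Carrier
B pat n = foldr ℚ[x]._+_ ℚ[x].0# (map (λ σ → X ^ₓ mch pat σ) (𝒮-avoiding (1 ∷ 3 ∷ 2 ∷ []) n))
  where
  module ℚ[x] = RawRing ℚ[x]
  open RawSemiringDefs ℚ[x].rawSemiring using () renaming (_^_ to _^ₓ_)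
  X : ℚ[x].Carrier
  X = Polynomial.indeterminate ℚ.+-*-rawRing

{-# OPTIONS --safe #-}

-- A nonempty 132-avoider is σ = L n R with every letter of L above every letter of R, where L and R
-- reduce to arbitrary 132-avoiders. A γ-match that uses the maximum n uses it as the letter m, so it
-- is a suffix of L reducing to δ = (a-1) 1 2 ⋯ (a-2) a ⋯ (m-2), then n, then the first letter of R.
-- Let G be the generating function of the avoiders ending with δ, C = B - 1 and W = B + (x-1) G.
-- The decomposition gives C = t (B + W C). Let G_i be the analogue of G for the first a - 1 + i
-- letters of δ, so that G = G_{m-a-1}. The maximum of this prefix is its last letter if i > 0 and its
-- first letter if i = 0, hence
--   G_{i+1} = t (G_i + W G_{i+1})   and   G_0 = t W (t^{a-2} + G_0),
-- where t^{a-2} comes from R = 1 2 ⋯ (a-2). An equation z = f + t W z has only one solution, so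
-- G_0 B = t^{a-2} W C and G_{i+1} B = G_i C. Thus G B^{m-a} = t^{a-2} W C^{m-a}; substituting this
-- into C = t (B + W C) yields the theorem, since B - 1 - t B = t W C.
module Submission where

open import Algebra.Bundles using (CommutativeRing; CommutativeSemiring)
open import Algebra.Bundles.Raw using (RawRing)
import Algebra.Morphism.RingMonomorphism as RingMonomorphism
open import Algebra.Morphism.Structures using (IsRingMonomorphism)
import Algebra.Properties.CommutativeMonoid.Sum as Sum
import Algebra.Properties.Semiring.Exp as Exp
import Algebra.Solver.Ring.NaturalCoefficients.Default as SemiringSolver
open import Data.Bool.Base using (true; false; if_then_else_)
open import Data.Empty using (⊥; ⊥-elim)
open import Data.Fin.Base using (Fin; zero; suc; toℕ; fromℕ<)
import Data.Fin.Properties as Finₚ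
open import Data.List.Base
  using (List; []; _∷_; _++_; [_]; map; filter; foldr; length; take; tails; applyUpTo; concat; tabulate; cartesianProduct)
open import Data.List.Membership.Propositional using (_∈_; _∉_)
open import Data.List.Membership.Propositional.Properties
open import Data.List.Membership.Propositional.Properties.WithK using (unique∧set⇒bag)
open import Data.List.Properties
open import Data.List.Relation.Binary.BagAndSetEquality using (∼bag⇒↭)
open import Data.List.Relation.Binary.Permutation.Propositional as Permutation using (_↭_; ↭⇒↭ₛ)
import Data.List.Relation.Binary.Permutation.Propositional.Properties as ↭
import Data.List.Relation.Binary.Permutation.Setoid.Properties as ↭ₛ
open import Data.List.Relation.Binary.Sublist.Propositional
  using (_⊆_; []; _∷_; _∷ʳ_; ⊆-refl; ⊆-trans; from∈; to∈; lookup)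
import Data.List.Relation.Binary.Sublist.Propositional.Properties as ⊆
open import Data.List.Relation.Unary.All as All using (All; []; _∷_)
import Data.List.Relation.Unary.All.Properties as Allₚ
open import Data.List.Relation.Unary.AllPairs using ([]; _∷_)
import Data.List.Relation.Unary.AllPairs.Properties as AllPairsₚ
open import Data.List.Relation.Unary.Any as Any using (Any; here; there; any?)
open import Data.List.Relation.Unary.Unique.Propositional using (Unique)
import Data.List.Relation.Unary.Unique.Propositional.Properties as Uniqueₚ
open import Data.Nat.Base as ℕ using (ℕ; zero; suc; _≤_; _∸_; z≤n; s≤s)
import Data.Nat.Properties as ℕₚ
open import Data.Nat.Solver using (module +-*-Solver)
open import Data.Product.Base using (∃; ∃₂; Σ-syntax; _×_; _,_; proj₁; proj₂; uncurry)
import Data.Rational.Properties as ℚₚ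
open import Data.Sum.Base using (_⊎_; inj₁; inj₂; [_,_]′)
open import Defs
  using (Word; red; mch; γ; interval; words; 𝒮; 𝒮-avoiding; Avoids; avoids?; module PowerSeries; module Polynomial)
open import Function.Base using (_∘_; id)
open import Function.Bundles using (mk⇔)
open import Level using (Level)
open import Relation.Binary.Bundles using (Setoid)
open import Relation.Binary.PropositionalEquality as ≡ using (_≡_; _≢_)
open import Relation.Binary.Structures using (IsEquivalence)
open import Relation.Nullary.Decidable using (Dec; yes; no; does; ¬?; _×-dec_)
open import Relation.Nullary.Negation using (¬_; contradiction)

private
  variable
    c ℓ : Level

-- Formal power series over a commutative ring.

module PowerSeriesRing (R : CommutativeRing c ℓ) where
  open CommutativeRing R hiding (zero)
  open PowerSeries rawRing using (Series; constant)
  private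
    module 𝕊 = PowerSeries rawRing
    module S = RawRing 𝕊.rawRing
  open import Relation.Binary.Reasoning.Setoid setoid
  open SemiringSolver commutativeSemiring using (solve; _:+_; _:*_; _:=_; con)

  infixl 7 _⊛_
  _⊛_ : Series → Series → Series
  _⊛_ = S._*_

  -- The sum over `Fin` in the product unfolds definitionally: `(f ⊛ g) (suc n)` is
  -- `f 0 * g (suc n) + (shift f ⊛ g) n`. The ring laws below follow by induction on the index,
  -- peeling off the constant term of the left factor.
  shift : Series → Series
  shift f n = f (suc n)

  -- Coefficient `n` of a product involves only coefficients of index at most `n`. This bounded
  -- congruence is what allows a recursive comparison of coefficients in `fixed-point-unique`.
  ⊛-cong-≤ : ∀ n {f f′ g g′ : Series} →
             (∀ i → i ≤ n → f i ≈ f′ i) → (∀ i → i ≤ n → g i ≈ g′ i) → (f ⊛ g) n ≈ (f′ ⊛ g′) n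
  ⊛-cong-≤ zero    f≈ g≈ = +-congʳ (*-cong (f≈ 0 z≤n) (g≈ 0 z≤n))
  ⊛-cong-≤ (suc n) f≈ g≈ = +-cong (*-cong (f≈ 0 z≤n) (g≈ (suc n) ℕₚ.≤-refl))
    (⊛-cong-≤ n (λ i → f≈ (suc i) ∘ s≤s) (λ i i≤n → g≈ i (ℕₚ.m≤n⇒m≤1+n i≤n)))

  ⊛-cong : ∀ {f f′ g g′ : Series} → f S.≈ f′ → g S.≈ g′ → (f ⊛ g) S.≈ (f′ ⊛ g′)
  ⊛-cong f≈ g≈ n = ⊛-cong-≤ n (λ i _ → f≈ i) (λ i _ → g≈ i)

  ⊛-zeroˡ : ∀ g → (S.0# ⊛ g) S.≈ S.0#
  ⊛-zeroˡ g zero    = trans (+-identityʳ _) (zeroˡ _)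
  ⊛-zeroˡ g (suc n) = trans (+-cong (zeroˡ _) (⊛-zeroˡ g n)) (+-identityʳ _)

  constant-⊛ : ∀ a g n → (constant a ⊛ g) n ≈ a * g n
  constant-⊛ a g zero    = +-identityʳ _
  constant-⊛ a g (suc n) = trans (+-congˡ (⊛-zeroˡ g n)) (+-identityʳ _)

  ⊛-distribʳ : ∀ h f g → ((f S.+ g) ⊛ h) S.≈ (f ⊛ h S.+ g ⊛ h)
  ⊛-distribʳ h f g zero    = solve 3 (λ x y z → (x :+ y) :* z :+ con 0 := (x :* z :+ con 0) :+ (y :* z :+ con 0)) refl _ _ _
  ⊛-distribʳ h f g (suc n) = begin
    (f 0 + g 0) * h (suc n) + ((shift f S.+ shift g) ⊛ h) n
      ≈⟨ +-congˡ (⊛-distribʳ h (shift f) (shift g) n) ⟩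
    (f 0 + g 0) * h (suc n) + ((shift f ⊛ h) n + (shift g ⊛ h) n)
      ≈⟨ solve 5 (λ x y z v w → (x :+ y) :* z :+ (v :+ w) := (x :* z :+ v) :+ (y :* z :+ w)) refl _ _ _ _ _ ⟩
    (f 0 * h (suc n) + (shift f ⊛ h) n) + (g 0 * h (suc n) + (shift g ⊛ h) n) ∎

  scale-⊛ : ∀ a f g n → ((λ i → a * f i) ⊛ g) n ≈ a * (f ⊛ g) n
  scale-⊛ a f g zero    = solve 3 (λ x y z → (x :* y) :* z :+ con 0 := x :* (y :* z :+ con 0)) refl _ _ _
  scale-⊛ a f g (suc n) = begin
    a * f 0 * g (suc n) + ((λ i → a * f (suc i)) ⊛ g) n
      ≈⟨ +-congˡ (scale-⊛ a (shift f) g n) ⟩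
    a * f 0 * g (suc n) + a * (shift f ⊛ g) n
      ≈⟨ solve 4 (λ x y z w → x :* y :* z :+ x :* w := x :* (y :* z :+ w)) refl _ _ _ _ ⟩
    a * (f 0 * g (suc n) + (shift f ⊛ g) n) ∎

  ⊛-assoc : ∀ f g h → ((f ⊛ g) ⊛ h) S.≈ (f ⊛ (g ⊛ h))
  ⊛-assoc f g h zero    = solve 3 (λ x y z → (x :* y :+ con 0) :* z :+ con 0 := x :* (y :* z :+ con 0) :+ con 0) refl _ _ _
  ⊛-assoc f g h (suc n) = begin
    (f 0 * g 0 + 0#) * h (suc n) + ((λ i → f 0 * g (suc i) + (shift f ⊛ g) i) ⊛ h) n
      ≈⟨ +-cong (*-congʳ (+-identityʳ _)) (⊛-distribʳ h (λ i → f 0 * g (suc i)) (shift f ⊛ g) n) ⟩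
    f 0 * g 0 * h (suc n) + (((λ i → f 0 * g (suc i)) ⊛ h) n + ((shift f ⊛ g) ⊛ h) n)
      ≈⟨ +-congˡ (+-cong (scale-⊛ (f 0) (shift g) h n) (⊛-assoc (shift f) g h n)) ⟩
    f 0 * g 0 * h (suc n) + (f 0 * (shift g ⊛ h) n + (shift f ⊛ (g ⊛ h)) n)
      ≈⟨ solve 5 (λ x y z v w → x :* y :* z :+ (x :* v :+ w) := x :* (y :* z :+ v) :+ w) refl _ _ _ _ _ ⟩
    f 0 * (g 0 * h (suc n) + (shift g ⊛ h) n) + (shift f ⊛ (g ⊛ h)) n ∎

  -- The mirror image of the definitional recursion, with the constant term of the right factor
  -- peeled off; commutativity plays the two against each other.
  ⊛-suc : ∀ f g n → (f ⊛ g) (suc n) ≈ (f ⊛ shift g) n + f (suc n) * g 0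
  ⊛-suc f g zero    = solve 2 (λ x y → x :+ (y :+ con 0) := (x :+ con 0) :+ y) refl _ _
  ⊛-suc f g (suc n) = trans (+-congˡ (⊛-suc (shift f) g n)) (sym (+-assoc _ _ _))

  ⊛-comm : ∀ f g → (f ⊛ g) S.≈ (g ⊛ f)
  ⊛-comm f g zero    = +-congʳ (*-comm _ _)
  ⊛-comm f g (suc n) = begin
    f 0 * g (suc n) + (shift f ⊛ g) n ≈⟨ +-comm _ _ ⟩
    (shift f ⊛ g) n + f 0 * g (suc n) ≈⟨ +-cong (⊛-comm (shift f) g n) (*-comm _ _) ⟩
    (g ⊛ shift f) n + g (suc n) * f 0 ≈⟨ ⊛-suc g f n ⟨
    (g ⊛ f) (suc n)                   ∎

  ≈-isEquivalence : IsEquivalence S._≈_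
  ≈-isEquivalence = record
    { refl  = λ _ → refl
    ; sym   = λ p n → sym (p n)
    ; trans = λ p q n → trans (p n) (q n)
    }

  ≈-setoid : Setoid c ℓ
  ≈-setoid = record { isEquivalence = ≈-isEquivalence }

  commutativeRing : CommutativeRing c ℓ
  commutativeRing = record
    { Carrier = Series
    ; _≈_ = S._≈_ ; _+_ = S._+_ ; _*_ = S._*_ ; -_ = S.-_ ; 0# = S.0# ; 1# = S.1#
    ; isCommutativeRing = record
      { isRing = record
        { +-isAbelianGroup = record
          { isGroup = record
            { isMonoid = record
              { isSemigroup = record
                { isMagma = record
                  { isEquivalence = ≈-isEquivalence
                  ; ∙-cong = λ p q n → +-cong (p n) (q n)
                  }
                ; assoc = λ f g h n → +-assoc _ _ _
                }
              ; identity = (λ f n → +-identityˡ _) , (λ f n → +-identityʳ _)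
              }
            ; inverse = (λ f n → -‿inverseˡ _) , (λ f n → -‿inverseʳ _)
            ; ⁻¹-cong = λ p n → -‿cong (p n)
            }
          ; comm = λ f g n → +-comm _ _
          }
        ; *-cong = ⊛-cong
        ; *-assoc = ⊛-assoc
        ; *-identity = comm∧idˡ⇒id ⊛-comm 1-⊛
        ; distrib = comm∧distrʳ⇒distr (λ p q n → +-cong (p n) (q n)) ⊛-comm ⊛-distribʳ
        }
      ; *-comm = ⊛-comm
      }
    }
    where
    open import Algebra.Consequences.Setoid ≈-setoid
      using (comm∧idˡ⇒id; comm∧distrʳ⇒distr)
    1-⊛ : ∀ f → (S.1# ⊛ f) S.≈ f
    1-⊛ f n = trans (constant-⊛ 1# f n) (*-identityˡ _)

  𝕥 : Series
  𝕥 = 𝕊.indeterminate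

  𝕥-⊛-zero : ∀ f → (𝕥 ⊛ f) 0 ≈ 0#
  𝕥-⊛-zero f = trans (+-identityʳ _) (zeroˡ _)

  𝕥-⊛-suc : ∀ f n → (𝕥 ⊛ f) (suc n) ≈ f n
  𝕥-⊛-suc f n = trans (+-congʳ (zeroˡ _)) (trans (+-identityˡ _) (trans (⊛-cong {g = f} shift-𝕥 (λ _ → refl) n)
    (trans (constant-⊛ 1# f n) (*-identityˡ _))))
    where
    shift-𝕥 : shift 𝕥 S.≈ constant 1#
    shift-𝕥 zero    = refl
    shift-𝕥 (suc n) = refl

  -- The equation z = f + t v z determines the coefficients of z recursively.
  fixed-point-unique : ∀ f v {z z′} → z S.≈ (f S.+ 𝕥 ⊛ (v ⊛ z)) → z′ S.≈ (f S.+ 𝕥 ⊛ (v ⊛ z′)) → z S.≈ z′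
  fixed-point-unique f v {z} {z′} z≈ z′≈ n = below (suc n) n ℕₚ.≤-refl
    where
    below : ∀ n i → suc i ≤ n → z i ≈ z′ i
    below (suc n) zero    _         = trans (z≈ 0) (trans (+-congˡ (trans (𝕥-⊛-zero (v ⊛ z)) (sym (𝕥-⊛-zero (v ⊛ z′))))) (sym (z′≈ 0)))
    below (suc n) (suc i) (s≤s i<n) = begin
      z (suc i)                            ≈⟨ z≈ (suc i) ⟩
      f (suc i) + (𝕥 ⊛ (v ⊛ z)) (suc i)    ≈⟨ +-congˡ (𝕥-⊛-suc (v ⊛ z) i) ⟩
      f (suc i) + (v ⊛ z) i                ≈⟨ +-congˡ (⊛-cong-≤ i {f = v} {g = z} (λ _ _ → refl) (λ j j≤i → below n j (ℕₚ.≤-trans (s≤s j≤i) i<n))) ⟩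
      f (suc i) + (v ⊛ z′) i               ≈⟨ +-congˡ (𝕥-⊛-suc (v ⊛ z′) i) ⟨
      f (suc i) + (𝕥 ⊛ (v ⊛ z′)) (suc i)   ≈⟨ z′≈ (suc i) ⟨
      z′ (suc i)                           ∎

-- Polynomials as a subring of the power series.

module PolynomialRing (R : CommutativeRing c ℓ) where
  open CommutativeRing R hiding (zero)
  private
    module S = CommutativeRing (PowerSeriesRing.commutativeRing R)
    module P = RawRing (Polynomial.rawRing rawRing)
  open Polynomial rawRing using (coeff)
  open PowerSeriesRing R using (⊛-zeroˡ; _⊛_)

  coeff-+ : ∀ p q → coeff (p P.+ q) S.≈ (coeff p S.+ coeff q)
  coeff-+ []      q       k       = sym (+-identityˡ _)
  coeff-+ (a ∷ p) []      k       = sym (+-identityʳ _)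
  coeff-+ (a ∷ p) (b ∷ q) zero    = refl
  coeff-+ (a ∷ p) (b ∷ q) (suc k) = coeff-+ p q k

  coeff-scale : ∀ a q k → coeff (map (a *_) q) k ≈ a * coeff q k
  coeff-scale a []      k       = sym (zeroʳ _)
  coeff-scale a (b ∷ q) zero    = refl
  coeff-scale a (b ∷ q) (suc k) = coeff-scale a q k

  coeff-* : ∀ p q → coeff (p P.* q) S.≈ (coeff p S.* coeff q)
  coeff-* []      q k = sym (⊛-zeroˡ (coeff q) k)
  coeff-* (a ∷ p) q k = trans (coeff-+ (map (a *_) q) (0# ∷ p P.* q) k) (step k)
    where
    step : ∀ k → coeff (map (a *_) q) k + coeff (0# ∷ p P.* q) k ≈ (coeff (a ∷ p) ⊛ coeff q) k
    step zero    = +-congʳ (coeff-scale a q 0)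
    step (suc k) = +-cong (coeff-scale a q (suc k)) (coeff-* p q k)

  coeff-neg : ∀ p → coeff (P.- p) S.≈ (S.- coeff p)
  coeff-neg []      k       = sym -0#≈0#
    where open import Algebra.Properties.Ring ring using (-0#≈0#)
  coeff-neg (a ∷ p) zero    = refl
  coeff-neg (a ∷ p) (suc k) = coeff-neg p k

  coeff-1 : coeff P.1# S.≈ S.1#
  coeff-1 zero    = refl
  coeff-1 (suc k) = refl

  -- Polynomials are compared coefficientwise, so `coeff` is injective by definition, and the ring
  -- laws of power series pull back along it.
  coeff-isRingMonomorphism : IsRingMonomorphism (Polynomial.rawRing rawRing) S.rawRing coeff
  coeff-isRingMonomorphism = record
    { isRingHomomorphism = record
      { isSemiringHomomorphism = record
        { isNearSemiringHomomorphism = record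
          { +-isMonoidHomomorphism = record
            { isMagmaHomomorphism = record
              { isRelHomomorphism = record { cong = id }
              ; homo = coeff-+
              }
            ; ε-homo = λ _ → refl
            }
          ; *-homo = coeff-*
          }
        ; 1#-homo = coeff-1
        }
      ; -‿homo = coeff-neg
      }
    ; injective = id
    }

  commutativeRing : CommutativeRing c ℓ
  commutativeRing = record
    { isCommutativeRing = RingMonomorphism.isCommutativeRing coeff-isRingMonomorphism S.isCommutativeRing }

-- Indicators of decidable propositions.

module Indicator {c ℓ} (R : CommutativeSemiring c ℓ) where
  open CommutativeSemiring R hiding (zero)

  -- Taken over any commutative semiring: with values in ℕ it counts matches, with values in the
  -- coefficient ring it selects words inside a weight.
  χ : ∀ {p} {P : Set p} → Dec P → Carrier
  χ P? = if does P? then 1# else 0#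

  χ-yes : ∀ {p} {P : Set p} (P? : Dec P) → P → χ P? ≈ 1#
  χ-yes (yes _) _ = refl
  χ-yes (no ¬p) p = contradiction p ¬p

  χ-no : ∀ {p} {P : Set p} (P? : Dec P) → ¬ P → χ P? ≈ 0#
  χ-no (yes p) ¬p = contradiction p ¬p
  χ-no (no _)  _  = refl

  χ-⇔ : ∀ {p q} {P : Set p} {Q : Set q} (P? : Dec P) (Q? : Dec Q) → (P → Q) → (Q → P) → χ P? ≈ χ Q?
  χ-⇔ (yes p) Q? f g = sym (χ-yes Q? (f p))
  χ-⇔ (no ¬p) Q? f g = sym (χ-no Q? (¬p ∘ g))

  χ-⊎ : ∀ {p q r} {P : Set p} {Q : Set q} {R : Set r} (P? : Dec P) (Q? : Dec Q) (R? : Dec R) →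
        (P → Q ⊎ R) → (Q → P) → (R → P) → (Q → ¬ R) → χ P? ≈ χ Q? + χ R?
  χ-⊎ P? (yes q) R? _ g _ ¬r = trans (χ-yes P? (g q)) (sym (trans (+-congˡ (χ-no R? (¬r q))) (+-identityʳ _)))
  χ-⊎ P? (no ¬q) R? f _ h _  = trans (χ-⇔ P? R? ([ (λ q → contradiction q ¬q) , id ]′ ∘ f) h) (sym (+-identityˡ _))

  χ-× : ∀ {p q r} {P : Set p} {Q : Set q} {R : Set r} (P? : Dec P) (Q? : Dec Q) (R? : Dec R) →
        (P → Q × R) → (Q → R → P) → χ P? ≈ χ Q? * χ R?
  χ-× P? (yes q) R? f g = trans (χ-⇔ P? R? (proj₂ ∘ f) (g q)) (sym (*-identityˡ _))
  χ-× P? (no ¬q) R? f g = trans (χ-no P? (¬q ∘ proj₁ ∘ f)) (sym (zeroˡ _))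

-- Algebraic elimination in the system of functional equations.

module FunctionalEquation (S : CommutativeRing c ℓ) where
  open CommutativeRing S hiding (zero)
  open Exp semiring using (_^_; ^-homo-*; ^-congˡ)
  open SemiringSolver commutativeSemiring using (solve; _:+_; _:*_; _:=_; con)
  open import Relation.Binary.Reasoning.Setoid setoid

  -- `E` and `O` are the series of the empty-word indicator and of the zero weight. They are kept
  -- apart from 1 and 0 so that the recursions have the two-product form in which `gf-glue` delivers
  -- them. `I i` stands for the series of the word 1 2 ⋯ i.
  module Solution
    (t b C W Y E O : Carrier) (G I : ℕ → Carrier) (c j : ℕ)
    (unique : ∀ f {z z′} → z ≈ f + t * (W * z) → z′ ≈ f + t * (W * z′) → z ≈ z′)
    (E≈1 : E ≈ 1#) (O≈0 : O ≈ 0#)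
    (b≈ : b ≈ E + C) (W≈ : W ≈ b + Y * G j) (C≈ : C ≈ t * (b * E + W * C))
    (I-zero : I 0 ≈ E) (I-suc : ∀ i → I (suc i) ≈ t * (I i * E + O * O))
    (G-zero : G 0 ≈ t * (W * I c + W * G 0))
    (G-suc : ∀ i → G (suc i) ≈ t * (G i * E + W * G (suc i)))
    where

    private
      T = t ^ c

      drop-E : ∀ f g → t * (f * E + g) ≈ t * f + t * g
      drop-E f g = trans (*-congˡ (+-congʳ (trans (*-congˡ E≈1) (*-identityʳ f)))) (distribˡ t f g)

    b≈1+C : b ≈ 1# + C
    b≈1+C = trans b≈ (+-congʳ E≈1)

    C-equation : C ≈ t * b + t * (W * C)
    C-equation = trans C≈ (drop-E b (W * C))

    I≈ : ∀ i → I i ≈ t ^ i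
    I≈ zero    = trans I-zero E≈1
    I≈ (suc i) = begin
      I (suc i)                 ≈⟨ I-suc i ⟩
      t * (I i * E + O * O)     ≈⟨ drop-E (I i) (O * O) ⟩
      t * I i + t * (O * O)     ≈⟨ +-cong (*-congˡ (I≈ i)) (*-congˡ (*-congʳ O≈0)) ⟩
      t * t ^ i + t * (0# * O)  ≈⟨ solve 3 (λ t p o → t :* p :+ t :* (con 0 :* o) := t :* p) refl t (t ^ i) O ⟩
      t ^ suc i                 ∎

    -- Both sides solve `z = t W T b + t W z`, the left one by `G-zero` and the right one by
    -- `C-equation`.
    G-zero-b : G 0 * b ≈ T * W * C
    G-zero-b = unique (t * (W * T) * b)
      (trans (*-congʳ (trans G-zero (*-congˡ (+-congʳ (*-congˡ (I≈ c))))))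
        (solve 5 (λ t w τ g b → (t :* (w :* τ :+ w :* g)) :* b := t :* (w :* τ) :* b :+ t :* (w :* (g :* b))) refl t W T (G 0) b))
      (trans (*-congˡ C-equation)
        (solve 5 (λ t w τ c b → τ :* w :* (t :* b :+ t :* (w :* c)) := t :* (w :* τ) :* b :+ t :* (w :* (τ :* w :* c))) refl t W T C b))

    -- The same uniqueness argument, with inhomogeneous term `t * G i * b`.
    G-suc-b : ∀ i → G (suc i) * b ≈ G i * C
    G-suc-b i = unique (t * G i * b)
      (trans (*-congʳ (trans (G-suc i) (drop-E (G i) _)))
        (solve 5 (λ t w g g′ b → (t :* g :+ t :* (w :* g′)) :* b := t :* g :* b :+ t :* (w :* (g′ :* b))) refl t W (G i) (G (suc i)) b))
      (trans (*-congˡ C-equation)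
        (solve 5 (λ t w g c b → g :* (t :* b :+ t :* (w :* c)) := t :* g :* b :+ t :* (w :* (g :* c))) refl t W (G i) C b))

    -- Each use of `G-suc-b` trades a factor `b` for a factor `C` and lowers the index of `G`, until
    -- `G-zero-b` ends the descent. Powers of `b` stay on the left, so nothing is divided.
    G-b^ : ∀ i → G i * b ^ suc i ≈ T * W * C ^ suc i
    G-b^ zero    = trans (*-congˡ (*-identityʳ b)) (trans G-zero-b (*-congˡ (sym (*-identityʳ C))))
    G-b^ (suc i) = begin
      G (suc i) * (b * b ^ suc i)   ≈⟨ *-assoc _ _ _ ⟨
      G (suc i) * b * b ^ suc i     ≈⟨ *-congʳ (G-suc-b i) ⟩
      G i * C * b ^ suc i           ≈⟨ solve 3 (λ g c p → g :* c :* p := c :* (g :* p)) refl (G i) C (b ^ suc i) ⟩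
      C * (G i * b ^ suc i)         ≈⟨ *-congˡ (G-b^ i) ⟩
      C * (T * W * C ^ suc i)       ≈⟨ solve 3 (λ z c q → c :* (z :* q) := z :* (c :* q)) refl (T * W) C (C ^ suc i) ⟩
      T * W * (C * C ^ suc i)       ∎

    [x+y]-x≈y : ∀ x y → (x + y) + - x ≈ y
    [x+y]-x≈y x y = begin
      (x + y) + - x    ≈⟨ solve 3 (λ x y z → (x :+ y) :+ z := y :+ (x :+ z)) refl x y (- x) ⟩
      y + (x + - x)    ≈⟨ +-congˡ (-‿inverseʳ x) ⟩
      y + 0#           ≈⟨ +-identityʳ y ⟩
      y                ∎

    b-1≈C : b + - 1# ≈ C
    b-1≈C = trans (+-congʳ b≈1+C) ([x+y]-x≈y 1# C)

    b-1-tb≈tWC : b + - 1# + - (t * b) ≈ t * (W * C)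
    b-1-tb≈tWC = trans (+-congʳ (trans b-1≈C C-equation)) ([x+y]-x≈y (t * b) _)

    -- C = t (b + W C) is applied to one factor C, and W = b + Y G to the W it produces.
    C-form : b * (C * b ^ j) ≈ t * b ^ (suc j ℕ.+ 2) + T * Y * (t * (W * C)) * C ^ suc j
    C-form = begin
      b * (C * b ^ j)
        ≈⟨ *-congˡ (*-congʳ (trans C-equation (+-congˡ (*-congˡ (*-congʳ W≈))))) ⟩
      b * ((t * b + t * ((b + Y * G j) * C)) * b ^ j)
        -- The terms from `t b` and `t b C` are collected into `1 + C`, placed so that reading it
        -- back as `b` completes a literal `b ^ 2`.
        ≈⟨ solve 6 (λ t b c y g p → b :* ((t :* b :+ t :* ((b :+ y :* g) :* c)) :* p) :=
               t :* (b :* p :* (b :* ((con 1 :+ c) :* con 1))) :+ y :* t :* c :* (g :* (b :* p)))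
             refl t b C Y (G j) (b ^ j) ⟩
      t * (b ^ suc j * (b * ((1# + C) * 1#))) + Y * t * C * (G j * b ^ suc j)
        ≈⟨ +-cong (*-congˡ (*-congˡ (*-congˡ (*-congʳ (sym b≈1+C))))) (*-congˡ (G-b^ j)) ⟩
      t * (b ^ suc j * b ^ 2) + Y * t * C * (T * W * C ^ suc j)
        ≈⟨ +-cong (*-congˡ (sym (^-homo-* b (suc j) 2)))
             (solve 6 (λ t w c y τ q → y :* t :* c :* (τ :* w :* q) := τ :* y :* (t :* (w :* c)) :* q) refl t W C Y T (C ^ suc j)) ⟩
      t * b ^ (suc j ℕ.+ 2) + T * Y * (t * (W * C)) * C ^ suc j ∎

    -- Cross-multiplied form of the claimed quotient: the last factor `1#` is the denominator of
    -- `ι b`. In terms of the pattern, `c` is a - 2 and `j` is m - a - 1.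
    functional-equation : ∀ x → Y ≈ x + - 1# →
      b * ((b + - 1#) * b ^ j) ≈
      (t * b ^ (suc j ℕ.+ 2) + t ^ c * (x + - 1#) * (b + - 1# + - (t * b)) * (b + - 1#) ^ suc j) * 1#
    functional-equation x Y≈ = begin
      b * ((b + - 1#) * b ^ j)    ≈⟨ *-congˡ (*-congʳ b-1≈C) ⟩
      b * (C * b ^ j)             ≈⟨ C-form ⟩
      t * b ^ (suc j ℕ.+ 2) + T * Y * (t * (W * C)) * C ^ suc j
        ≈⟨ +-congˡ (*-cong (*-cong (*-congˡ Y≈) (sym b-1-tb≈tWC)) (^-congˡ (suc j) (sym b-1≈C))) ⟩
      t * b ^ (suc j ℕ.+ 2) + T * (x + - 1#) * (b + - 1# + - (t * b)) * (b + - 1#) ^ suc j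
        ≈⟨ *-identityʳ _ ⟨
      (t * b ^ (suc j ℕ.+ 2) + T * (x + - 1#) * (b + - 1# + - (t * b)) * (b + - 1#) ^ suc j) * 1# ∎

-- Ranks and reductions of words.

module Combinatorics where
  open import Data.Nat.Base using (_+_; _*_; _<_; _⊓_)
  open import Data.Nat.Properties
  open import Data.List.Membership.DecPropositional _≟_ using (_∈?_)
  open import Data.List.Relation.Unary.Unique.DecPropositional _≟_ using (unique?)
  open ≡ using (refl; sym; trans; cong; cong₂; subst; setoid; module ≡-Reasoning)

  -- `red w` is by definition `map (λ v → rank v w) w`, so facts about reductions are obtained from
  -- facts about ranks.
  rank : ℕ → Word → ℕ
  rank v w = length (filter (_≤? v) w)

  rank-all : ∀ {v w} → All (_≤ v) w → rank v w ≡ length w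
  rank-all = cong length ∘ filter-all (_≤? _)

  rank-none : ∀ {v w} → All (v <_) w → rank v w ≡ 0
  rank-none = cong length ∘ filter-none (_≤? _) ∘ All.map <⇒≱

  rank-++ : ∀ v w₁ w₂ → rank v (w₁ ++ w₂) ≡ rank v w₁ + rank v w₂
  rank-++ v w₁ w₂ = trans (cong length (filter-++ (_≤? v) w₁ w₂)) (length-++ (filter (_≤? v) w₁))

  rank-accept : ∀ {v y} w → y ≤ v → rank v (y ∷ w) ≡ suc (rank v w)
  rank-accept w y≤v = cong length (filter-accept (_≤? _) y≤v)

  rank-reject : ∀ {v y} w → v < y → rank v (y ∷ w) ≡ rank v w
  rank-reject w v<y = cong length (filter-reject (_≤? _) (<⇒≱ v<y))

  rank-shift : ∀ c v w → rank (c + v) (map (c +_) w) ≡ rank v w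
  rank-shift c v []      = refl
  rank-shift c v (y ∷ w) with y ≤? v
  ... | yes y≤v = trans (rank-accept _ (+-monoʳ-≤ c y≤v)) (trans (cong suc (rank-shift c v w)) (sym (rank-accept w y≤v)))
  ... | no  y≰v = trans (rank-reject _ (+-monoʳ-< c (≰⇒> y≰v))) (trans (rank-shift c v w) (sym (rank-reject w (≰⇒> y≰v))))

  red-shift : ∀ c w → red (map (c +_) w) ≡ red w
  red-shift c w = trans (sym (map-∘ w)) (map-cong (λ v → rank-shift c v w) w)

  length-red : ∀ w → length (red w) ≡ length w
  length-red w = length-map _ w

  -- The shape of a 132-avoider around its maximum `p`. It is inherited by suffixes of `l` and
  -- prefixes of `r`, hence by the windows that contain `p`.
  record Peak (l : Word) (p : ℕ) (r : Word) : Set where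
    constructor peak
    field
      left  : All (_< p) l
      right : All (_< p) r
      cross : All (λ x → All (_< x) r) l

  peak-tail : ∀ {x l p r} → Peak (x ∷ l) p r → Peak l p r
  peak-tail (peak (_ ∷ l<) r< (_ ∷ c)) = peak l< r< c

  peak-take : ∀ k {l p r} → Peak l p r → Peak l p (take k r)
  peak-take k (peak l< r< c) = peak l< (Allₚ.take⁺ k r<) (All.map (Allₚ.take⁺ k) c)

  -- All letters of `r` lie below the rest, so they keep their own ranks and raise every rank in `l`
  -- by `length r`; the maximum has rank equal to the total length.
  red-peak : ∀ {l p r} → Peak l p r →
             red (l ++ p ∷ r) ≡ map (length r +_) (red l) ++ (length l + suc (length r)) ∷ red r
  red-peak {l} {p} {r} (peak l<p r<p cross) = begin
    red w                                 ≡⟨ map-++ _ l (p ∷ r) ⟩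
    map (λ x → rank x w) l ++ rank p w ∷ map (λ x → rank x w) r
      ≡⟨ cong₂ _++_ (map-cong-local (All.zipWith (λ (x<p , r<x) → rank-left x<p r<x) (l<p , cross)))
           (cong₂ _∷_ rank-p (map-cong-local (All.tabulate λ y∈r →
           rank-right (All.lookup r<p y∈r) (All.map (λ r<x → All.lookup r<x y∈r) cross)))) ⟩
    map (λ x → length r + rank x l) l ++ (length l + suc (length r)) ∷ red r
      ≡⟨ cong (_++ (length l + suc (length r)) ∷ red r) (map-∘ l) ⟩
    map (length r +_) (red l) ++ (length l + suc (length r)) ∷ red r ∎
    where
    open ≡-Reasoning
    w = l ++ p ∷ r

    rank-left : ∀ {x} → x < p → All (_< x) r → rank x w ≡ length r + rank x l
    rank-left {x} x<p r<x = begin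
      rank x w                     ≡⟨ rank-++ x l (p ∷ r) ⟩
      rank x l + rank x (p ∷ r)    ≡⟨ cong (rank x l +_) (trans (rank-reject r x<p) (rank-all (All.map <⇒≤ r<x))) ⟩
      rank x l + length r          ≡⟨ +-comm (rank x l) _ ⟩
      length r + rank x l          ∎

    rank-p : rank p w ≡ length l + suc (length r)
    rank-p = trans (rank-++ p l (p ∷ r)) (cong₂ _+_ (rank-all (All.map <⇒≤ l<p))
      (rank-all (≤-refl ∷ All.map <⇒≤ r<p)))

    rank-right : ∀ {y} → y < p → All (y <_) l → rank y w ≡ rank y r
    rank-right {y} y<p y<l = trans (rank-++ y l (p ∷ r)) (cong₂ _+_ (rank-none y<l) (rank-reject r y<p))

  -- On the right-hand side `p` occurs only once, so the marked occurrence must sit at the same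
  -- place on both sides.
  ++-∷-injective : ∀ {a} {A : Set a} {p : A} {xs ys} xs′ {ys′} → p ∉ xs′ → p ∉ ys′ →
                   xs ++ p ∷ ys ≡ xs′ ++ p ∷ ys′ → xs ≡ xs′ × ys ≡ ys′
  ++-∷-injective {xs = []}     []        _    _    eq = refl , ∷-injectiveʳ eq
  ++-∷-injective {xs = []}     (_ ∷ _)   p∉xs _    eq = contradiction (here (∷-injectiveˡ eq)) p∉xs
  ++-∷-injective {p = p} {xs = x ∷ xs} [] _ p∉ys   eq =
    contradiction (subst (p ∈_) (∷-injectiveʳ eq) (∈-++⁺ʳ xs (here refl))) p∉ys
  ++-∷-injective {xs = x ∷ xs} (x′ ∷ xs′) p∉xs p∉ys eq =
    let xs≡ , ys≡ = ++-∷-injective xs′ (p∉xs ∘ there) p∉ys (∷-injectiveʳ eq)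
    in cong₂ _∷_ (∷-injectiveˡ eq) xs≡ , ys≡

  -- In a reduced word π₁ ++ q ∷ π₂ the maximum q is the length.
  record Peaked (π₁ : Word) (q : ℕ) (π₂ : Word) : Set where
    constructor peaked
    field
      q≡   : length π₁ + suc (length π₂) ≡ q
      left : q ∉ π₁
      right : q ∉ π₂

  module _ {l p r} (pk : Peak l p r) {π₁ q π₂} (pkd : Peaked π₁ q π₂) where
    open Peaked pkd

    -- Equal words have equal lengths, and in both the marked maximum is the length. Its single
    -- occurrence in the pattern then aligns the two cuts.
    red-peak⁻ : red (l ++ p ∷ r) ≡ π₁ ++ q ∷ π₂ → map (length r +_) (red l) ≡ π₁ × red r ≡ π₂
    red-peak⁻ eq = ++-∷-injective π₁ left right
      (trans (cong (λ k → map _ (red l) ++ k ∷ red r) (sym size)) (trans (sym (red-peak pk)) eq))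
      where
      open ≡-Reasoning
      size : length l + suc (length r) ≡ q
      size = begin
        length l + suc (length r)      ≡⟨ length-++ l ⟨
        length (l ++ p ∷ r)            ≡⟨ length-red (l ++ p ∷ r) ⟨
        length (red (l ++ p ∷ r))      ≡⟨ cong length eq ⟩
        length (π₁ ++ q ∷ π₂)          ≡⟨ length-++ π₁ ⟩
        length π₁ + suc (length π₂)    ≡⟨ q≡ ⟩
        q                              ∎

    red-peak⁺ : map (length r +_) (red l) ≡ π₁ → red r ≡ π₂ → red (l ++ p ∷ r) ≡ π₁ ++ q ∷ π₂
    red-peak⁺ refl refl = trans (red-peak pk) (cong (λ k → _ ++ k ∷ red r)
      (trans (sym (cong₂ (λ i j → i + suc j) (trans (length-map _ (red l)) (length-red l)) (length-red r))) q≡))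

  -- Suffixes with a prescribed reduction.

  EndsWith : Word → Word → Set
  EndsWith π w = Any (λ v → red v ≡ π) (tails w)

  endsWith? : ∀ π w → Dec (EndsWith π w)
  endsWith? π w = any? (λ v → ≡-dec _≟_ (red v) π) (tails w)

  endsWith-length : ∀ {π} w → EndsWith π w → length π ≤ length w
  endsWith-length []      (here refl) = z≤n
  endsWith-length (x ∷ w) (here refl) = ≤-reflexive (length-red (x ∷ w))
  endsWith-length (x ∷ w) (there e)   = m≤n⇒m≤1+n (endsWith-length w e)

  module _ {π : Word} (c : ℕ) where
    endsWith-shift⁻ : ∀ w → EndsWith π (map (c +_) w) → EndsWith π w
    endsWith-shift⁻ []      e         = e
    endsWith-shift⁻ (x ∷ w) (here eq) = here (trans (sym (red-shift c (x ∷ w))) eq)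
    endsWith-shift⁻ (x ∷ w) (there e) = there (endsWith-shift⁻ w e)

    endsWith-shift⁺ : ∀ w → EndsWith π w → EndsWith π (map (c +_) w)
    endsWith-shift⁺ []      e         = e
    endsWith-shift⁺ (x ∷ w) (here eq) = here (trans (red-shift c (x ∷ w)) eq)
    endsWith-shift⁺ (x ∷ w) (there e) = there (endsWith-shift⁺ w e)

  module _ {π₁ q π₂} (pkd : Peaked π₁ q π₂) where
    private
      π = π₁ ++ q ∷ π₂
      EndsLeft : Word → Word → Set
      EndsLeft l r = Any (λ v → map (length r +_) (red v) ≡ π₁) (tails l) × red r ≡ π₂

    -- A suffix of `l ++ p ∷ r` either contains `p`, which then plays the role of `q` and splits the
    -- match, or lies inside `r`.
    endsWith-peak⁻ : ∀ {l p r} → Peak l p r → EndsWith π (l ++ p ∷ r) → EndsLeft l r ⊎ EndsWith π r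
    endsWith-peak⁻ {[]}    pk (here eq) = let l≡ , r≡ = red-peak⁻ pk pkd eq in inj₁ (here l≡ , r≡)
    endsWith-peak⁻ {[]}    pk (there e) = inj₂ e
    endsWith-peak⁻ {x ∷ l} pk (here eq) = let l≡ , r≡ = red-peak⁻ pk pkd eq in inj₁ (here l≡ , r≡)
    endsWith-peak⁻ {x ∷ l} pk (there e) with endsWith-peak⁻ (peak-tail pk) e
    ... | inj₁ (e′ , r≡) = inj₁ (there e′ , r≡)
    ... | inj₂ e′        = inj₂ e′

    endsWith-peak⁺ : ∀ {l p r} → Peak l p r → EndsLeft l r ⊎ EndsWith π r → EndsWith π (l ++ p ∷ r)
    endsWith-peak⁺ {[]}    pk (inj₁ (here l≡ , r≡))  = here (red-peak⁺ pk pkd l≡ r≡)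
    endsWith-peak⁺ {[]}    pk (inj₂ e)               = there e
    endsWith-peak⁺ {x ∷ l} pk (inj₁ (here l≡ , r≡))  = here (red-peak⁺ pk pkd l≡ r≡)
    endsWith-peak⁺ {x ∷ l} pk (inj₁ (there e , r≡))  = there (endsWith-peak⁺ (peak-tail pk) (inj₁ (e , r≡)))
    endsWith-peak⁺ {x ∷ l} pk (inj₂ e)               = there (endsWith-peak⁺ (peak-tail pk) (inj₂ e))

  -- The pattern and the prefixes of its initial part.

  -- For c = a - 2, the reduction of the first a - 1 + j letters of γ.
  δ : ℕ → ℕ → Word
  δ c zero    = suc c ∷ applyUpTo suc c
  δ c (suc j) = δ c j ++ [ suc (suc (c + j)) ]

  length-δ : ∀ c j → length (δ c j) ≡ suc (c + j)
  length-δ c zero    = cong suc (trans (length-applyUpTo suc c) (sym (+-identityʳ c)))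
  length-δ c (suc j) = trans (length-++ (δ c j)) (trans (+-comm _ 1) (cong suc (trans (length-δ c j) (sym (+-suc c j)))))

  δ-bounded : ∀ c j → All (_≤ suc (c + j)) (δ c j)
  δ-bounded c zero    = s≤s (m≤m+n c 0) ∷ Allₚ.applyUpTo⁺₁ suc c (λ i<c → ≤-trans i<c (≤-trans (m≤m+n c 0) (n≤1+n _)))
  δ-bounded c (suc j) = Allₚ.++⁺ (All.map (λ p → ≤-trans p (s≤s (+-monoʳ-≤ c (n≤1+n j)))) (δ-bounded c j))
    (≤-reflexive (cong suc (sym (+-suc c j))) ∷ [])

  bounded⇒∉ : ∀ {b q w} → All (_≤ b) w → b < q → q ∉ w
  bounded⇒∉ ≤b b<q q∈w = <⇒≱ b<q (All.lookup ≤b q∈w)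

  δ-zero-peaked : ∀ c → Peaked [] (suc c) (applyUpTo suc c)
  δ-zero-peaked c = peaked (cong suc (length-applyUpTo suc c)) (λ ()) (bounded⇒∉ (Allₚ.applyUpTo⁺₁ suc c id) ≤-refl)

  δ-suc-peaked : ∀ c j → Peaked (δ c j) (suc (suc (c + j))) []
  δ-suc-peaked c j = peaked (trans (+-comm _ 1) (cong suc (length-δ c j))) (bounded⇒∉ (δ-bounded c j) ≤-refl) (λ ())

  upTo-suc-peaked : ∀ j → Peaked (applyUpTo suc j) (suc j) []
  upTo-suc-peaked j = peaked (trans (+-comm _ 1) (cong suc (length-applyUpTo suc j)))
    (bounded⇒∉ (Allₚ.applyUpTo⁺₁ suc j id) ≤-refl) (λ ())

  -- The final letter 1 is below all others, so what precedes the maximum m is `δ c j` raised by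
  -- one. Here a is `2 + c` and m is `3 + (c + j)`.
  γ≡ : ∀ c j → γ (2 + c) (3 + (c + j)) ≡ map suc (δ c j) ++ (3 + (c + j)) ∷ [ 1 ]
  γ≡ c j = begin
    (2 + c) ∷ applyUpTo (2 +_) c ++ applyUpTo (3 + c +_) (suc (c + j) ∸ c) ++ [ 1 ]
      ≡⟨ cong (λ k → (2 + c) ∷ applyUpTo (2 +_) c ++ applyUpTo (3 + c +_) k ++ [ 1 ])
           (trans (+-∸-assoc 1 (m≤m+n c j)) (cong suc (m+n∸m≡n c j))) ⟩
    (2 + c) ∷ applyUpTo (2 +_) c ++ applyUpTo (3 + c +_) (suc j) ++ [ 1 ]
      ≡⟨ ++-assoc ((2 + c) ∷ applyUpTo (2 +_) c) (applyUpTo (3 + c +_) (suc j)) [ 1 ] ⟨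
    ((2 + c) ∷ applyUpTo (2 +_) c ++ applyUpTo (3 + c +_) (suc j)) ++ [ 1 ]
      ≡⟨ cong (_++ [ 1 ]) (step j) ⟩
    (map suc (δ c j) ++ [ 3 + (c + j) ]) ++ [ 1 ]
      ≡⟨ ++-assoc (map suc (δ c j)) _ _ ⟩
    map suc (δ c j) ++ (3 + (c + j)) ∷ [ 1 ] ∎
    where
    open ≡-Reasoning
    w = (2 + c) ∷ applyUpTo (2 +_) c
    step : ∀ j → w ++ applyUpTo (3 + c +_) (suc j) ≡ map suc (δ c j) ++ [ 3 + (c + j) ]
    step zero    = cong (_++ [ 3 + (c + 0) ]) (cong ((2 + c) ∷_) (sym (map-applyUpTo suc suc c)))
    step (suc j) = begin
      w ++ applyUpTo (3 + c +_) (2 + j)                              ≡⟨ cong (w ++_) (applyUpTo-∷ʳ (3 + c +_) (suc j)) ⟨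
      w ++ (applyUpTo (3 + c +_) (suc j) ++ [ 3 + (c + suc j) ])     ≡⟨ ++-assoc w _ _ ⟨
      (w ++ applyUpTo (3 + c +_) (suc j)) ++ [ 3 + (c + suc j) ]     ≡⟨ cong (_++ [ 3 + (c + suc j) ]) (step j) ⟩
      (map suc (δ c j) ++ [ 3 + (c + j) ]) ++ [ 3 + (c + suc j) ]    ≡⟨ cong (_++ [ 3 + (c + suc j) ]) (map-++ suc (δ c j) _) ⟨
      map suc (δ c (suc j)) ++ [ 3 + (c + suc j) ]                   ∎

  γ-peaked : ∀ c j → Peaked (map suc (δ c j)) (3 + (c + j)) [ 1 ]
  γ-peaked c j = peaked (trans (+-comm _ 2) (cong (2 +_) (trans (length-map suc (δ c j)) (length-δ c j))))
    (bounded⇒∉ (Allₚ.map⁺ (All.map s≤s (δ-bounded c j))) ≤-refl) (λ { (here ()) })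

  ¬endsWith-[] : ∀ {i j} → ¬ EndsWith (δ i j) []
  ¬endsWith-[] {i} {j} e = 1+n≰n {0}
    (≤-trans (s≤s z≤n) (≤-trans (≤-reflexive (sym (length-δ i j))) (endsWith-length [] e)))

  -- Counting matches around the maximum.

  open Indicator +-*-commutativeSemiring

  empty? : (w : Word) → Dec (w ≡ [])
  empty? w = ≡-dec _≟_ w []

  take-length-++ : ∀ {a} {A : Set a} k (xs ys : List A) → take (length xs + k) (xs ++ ys) ≡ xs ++ take k ys
  take-length-++ k []       ys = refl
  take-length-++ k (x ∷ xs) ys = cong (x ∷_) (take-length-++ k xs ys)

  take-≤-++ : ∀ {a} {A : Set a} k (xs ys : List A) → k ≤ length xs → take k (xs ++ ys) ≡ take k xs
  take-≤-++ zero    xs       ys _         = refl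
  take-≤-++ (suc k) (x ∷ xs) ys (s≤s k≤) = cong (x ∷_) (take-≤-++ k xs ys k≤)

  Starts : Word → Word → Set
  Starts π w = red (take (length π) w) ≡ π

  starts? : ∀ π w → Dec (Starts π w)
  starts? π w = ≡-dec _≟_ (red (take (length π) w)) π

  starts-length : ∀ π w → Starts π w → length π ≤ length w
  starts-length π w eq = begin
    length π                           ≡⟨ cong length eq ⟨
    length (red (take (length π) w))   ≡⟨ length-red (take (length π) w) ⟩
    length (take (length π) w)         ≡⟨ length-take (length π) w ⟩
    length π ⊓ length w                ≤⟨ m⊓n≤n (length π) (length w) ⟩
    length w                           ∎
    where open ≤-Reasoning

  starts-shift : ∀ (π : Word) k w → red (take (length π) (map (k +_) w)) ≡ red (take (length π) w)
  starts-shift π k w = trans (cong red (take-map (length π) w)) (red-shift k (take (length π) w))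

  mch-∷ : ∀ π x w → mch π (x ∷ w) ≡ χ (starts? π (x ∷ w)) + mch π w
  mch-∷ π x w with does (starts? π (x ∷ w))
  ... | true  = refl
  ... | false = refl

  -- The list `tails []` still contains the empty suffix, so the empty word has one starting
  -- position to test; `¬starts-[]` later rules it out for the pattern at hand.
  mch-[] : ∀ π → mch π [] ≡ χ (starts? π [])
  mch-[] π with does (starts? π [])
  ... | true  = refl
  ... | false = refl

  mch-shift : ∀ π k w → mch π (map (k +_) w) ≡ mch π w
  mch-shift π k []      = refl
  mch-shift π k (x ∷ w) = begin
    mch π (map (k +_) (x ∷ w))                                  ≡⟨ mch-∷ π (k + x) (map (k +_) w) ⟩
    χ (starts? π (map (k +_) (x ∷ w))) + mch π (map (k +_) w)
      ≡⟨ cong₂ _+_ (χ-⇔ (starts? π (map (k +_) (x ∷ w))) (starts? π (x ∷ w))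
           (trans (sym (starts-shift π k (x ∷ w)))) (trans (starts-shift π k (x ∷ w)))) (mch-shift π k w) ⟩
    χ (starts? π (x ∷ w)) + mch π w                             ≡⟨ mch-∷ π x w ⟨
    mch π (x ∷ w)                                               ∎
    where open ≡-Reasoning

  module _ {ρ q} (pkd : Peaked (map suc ρ) q [ 1 ]) where
    private
      π = map suc ρ ++ q ∷ [ 1 ]

      length-π : length π ≡ length ρ + 2
      length-π = trans (length-++ (map suc ρ)) (cong (_+ 2) (length-map suc ρ))

      ρ<π : length ρ < length π
      ρ<π = ≤-trans (≤-reflexive (+-comm 1 (length ρ))) (≤-trans (+-monoʳ-≤ (length ρ) (s≤s z≤n)) (≤-reflexive (sym length-π)))

    -- An initial window that reaches beyond `l` contains `p`, which must play the maximum `q`. The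
    -- letters before it are then all of `l`, and exactly one letter follows it.
    starts-peak⁻ : ∀ {l p r} → Peak l p r → Starts π (l ++ p ∷ r) → (red l ≡ ρ × r ≢ []) ⊎ Starts π l
    starts-peak⁻ {l} {p} {r} pk st with length π ≤? length l
    ... | yes π≤l = inj₂ (trans (cong red (sym (take-≤-++ (length π) l (p ∷ r) π≤l))) st)
    ... | no  π≰l with m≤n⇒∃[o]m+o≡n (≰⇒> π≰l)
    -- `k` is the number of places of the window after `p`.
    ...   | k , eq = inj₁ (l≡ , λ { refl → r≢[] refl })
      where
      window : take (length π) (l ++ p ∷ r) ≡ l ++ p ∷ take k r
      window = trans (cong (λ i → take i (l ++ p ∷ r)) (trans (sym eq) (sym (+-suc (length l) k))))
        (take-length-++ (suc k) l (p ∷ r))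
      matched : map (length (take k r) +_) (red l) ≡ map suc ρ × red (take k r) ≡ [ 1 ]
      matched = red-peak⁻ (peak-take k pk) pkd (trans (cong red (sym window)) st)
      one : length (take k r) ≡ 1
      one = trans (sym (length-red (take k r))) (cong length (proj₂ matched))
      l≡ : red l ≡ ρ
      l≡ = map-injective suc-injective (trans (cong (λ i → map (i +_) (red l)) (sym one)) (proj₁ matched))
      r≢[] : r ≢ []
      r≢[] refl with subst (λ v → length v ≡ 1) (take-[] k) one
      ... | ()

    starts-peak⁺ : ∀ {l p r} → Peak l p r → (red l ≡ ρ × r ≢ []) ⊎ Starts π l → Starts π (l ++ p ∷ r)
    starts-peak⁺ {l} {p} {r} pk (inj₂ st) = trans (cong red (take-≤-++ (length π) l (p ∷ r) (starts-length π l st))) st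
    starts-peak⁺ {l} {p} {[]}    pk (inj₁ (l≡ , r≢[])) = contradiction refl r≢[]
    starts-peak⁺ {l} {p} {y ∷ r} pk (inj₁ (l≡ , _))    =
      trans (cong red window) (red-peak⁺ (peak-take 1 pk) pkd (cong (map suc) l≡) (cong [_] (rank-all (≤-refl {y} ∷ []))))
      where
      window : take (length π) (l ++ p ∷ y ∷ r) ≡ l ++ p ∷ [ y ]
      window = trans
        (cong (λ i → take i (l ++ p ∷ y ∷ r)) (trans length-π (cong (_+ 2) (trans (cong length (sym l≡)) (length-red l)))))
        (take-length-++ 2 l (p ∷ y ∷ r))

    χ-starts-peak : ∀ {l p r} → Peak l p r →
      χ (starts? π (l ++ p ∷ r)) ≡ χ (≡-dec _≟_ (red l) ρ) * χ (¬? (empty? r)) + χ (starts? π l)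
    χ-starts-peak {l} {p} {r} pk = trans
      (χ-⊎ (starts? π (l ++ p ∷ r)) both (starts? π l) (starts-peak⁻ pk) (starts-peak⁺ pk ∘ inj₁) (starts-peak⁺ pk ∘ inj₂)
        -- The cases exclude each other by length: `l` is as long as `ρ` in the first and at least
        -- as long as `π` in the second.
        (λ (l≡ , _) st → <⇒≱ ρ<π (≤-trans (starts-length π l st) (≤-reflexive (trans (sym (length-red l)) (cong length l≡))))))
      (cong (_+ χ (starts? π l)) (χ-× both (≡-dec _≟_ (red l) ρ) (¬? (empty? r)) id _,_))
      where
      both : Dec (red l ≡ ρ × r ≢ [])
      both = ≡-dec _≟_ (red l) ρ ×-dec ¬? (empty? r)

    χ-endsWith-∷ : ∀ x w → χ (endsWith? ρ (x ∷ w)) ≡ χ (≡-dec _≟_ (red (x ∷ w)) ρ) + χ (endsWith? ρ w)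
    χ-endsWith-∷ x w = χ-⊎ (endsWith? ρ (x ∷ w)) (≡-dec _≟_ (red (x ∷ w)) ρ) (endsWith? ρ w)
      (λ { (here eq) → inj₁ eq ; (there e) → inj₂ e }) here there
      (λ eq e → 1+n≰n (≤-trans (≤-reflexive (trans (sym (length-red (x ∷ w))) (cong length eq))) (endsWith-length w e)))

    -- A window starting at a suffix of `l` either matches inside `l` or uses `p`, and the latter
    -- means that the suffix reduces to `ρ` and `r` is nonempty. Only one suffix has the length of
    -- `ρ`, so these contributions add up to a single indicator.
    mch-peak : ∀ {l p r} → Peak l p r →
               mch π (l ++ p ∷ r) ≡ (mch π l + mch π r) + χ (endsWith? ρ l) * χ (¬? (empty? r))
    mch-peak {[]} {p} {r} pk = begin
      mch π (p ∷ r)                                     ≡⟨ mch-∷ π p r ⟩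
      χ (starts? π (p ∷ r)) + mch π r                   ≡⟨ cong (_+ mch π r) (χ-starts-peak pk) ⟩
      (E * N + χ (starts? π [])) + mch π r              ≡⟨ cong (λ k → (E * N + k) + mch π r) (mch-[] π) ⟨
      (E * N + mch π []) + mch π r
        ≡⟨ solve 4 (λ a b c d → (a :* b :+ c) :+ d := (c :+ d) :+ a :* b) refl E N (mch π []) (mch π r) ⟩
      (mch π [] + mch π r) + E * N                      ≡⟨ cong (λ k → (mch π [] + mch π r) + k * N) E≡ ⟩
      (mch π [] + mch π r) + χ (endsWith? ρ []) * N     ∎
      where
      open ≡-Reasoning
      open +-*-Solver using (solve; _:+_; _:*_; _:=_)
      E = χ (≡-dec _≟_ (red []) ρ)
      N = χ (¬? (empty? r))
      E≡ : E ≡ χ (endsWith? ρ [])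
      E≡ = χ-⇔ (≡-dec _≟_ (red []) ρ) (endsWith? ρ []) here (λ { (here eq) → eq })
    mch-peak {x ∷ l} {p} {r} pk = begin
      mch π (x ∷ l ++ p ∷ r)                            ≡⟨ mch-∷ π x (l ++ p ∷ r) ⟩
      χ (starts? π (x ∷ l ++ p ∷ r)) + mch π (l ++ p ∷ r) ≡⟨ cong₂ _+_ (χ-starts-peak pk) (mch-peak (peak-tail pk)) ⟩
      (E * N + H) + ((mch π l + mch π r) + F * N)
        ≡⟨ solve 6 (λ a b c d e f → (a :* b :+ c) :+ ((d :+ e) :+ f :* b) := ((c :+ d) :+ e) :+ (a :+ f) :* b)
             refl E N H (mch π l) (mch π r) F ⟩
      ((H + mch π l) + mch π r) + (E + F) * N           ≡⟨ cong₂ (λ i k → (i + mch π r) + k * N) (mch-∷ π x l) (χ-endsWith-∷ x l) ⟨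
      (mch π (x ∷ l) + mch π r) + χ (endsWith? ρ (x ∷ l)) * N ∎
      where
      open ≡-Reasoning
      open +-*-Solver using (solve; _:+_; _:*_; _:=_)
      E = χ (≡-dec _≟_ (red (x ∷ l)) ρ)
      N = χ (¬? (empty? r))
      H = χ (starts? π (x ∷ l))
      F = χ (endsWith? ρ l)

  -- Avoidance of 132 as a condition on the order of letters.

  132-free : Word → Set
  132-free w = ∀ {a b c} → a ∷ b ∷ c ∷ [] ⊆ w → a < c → c < b → ⊥

  -- If `c ≤ a`, the rank of `a` would exceed 1; if `b ≤ c`, the rank of `c` would be 3.
  red≡132 : ∀ {a b c} → red (a ∷ b ∷ c ∷ []) ≡ 1 ∷ 3 ∷ 2 ∷ [] → a < c × c < b
  red≡132 {a} {b} {c} eq = a<c , c<b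
    where
    rank-a : rank a (b ∷ c ∷ []) ≡ 0
    rank-a = suc-injective (trans (sym (rank-accept (b ∷ c ∷ []) ≤-refl)) (∷-injectiveˡ eq))

    a<c : a < c
    a<c with c ≤? a | rank-++ a [ b ] [ c ]
    ... | no  c≰a | _  = ≰⇒> c≰a
    ... | yes c≤a | eq′ = contradiction
      (trans (sym (+-suc (rank a [ b ]) 0)) (trans (cong (rank a [ b ] +_) (sym (rank-accept [] c≤a))) (trans (sym eq′) rank-a))) λ ()

    c<b : c < b
    c<b with b ≤? c
    ... | no  b≰c = ≰⇒> b≰c
    ... | yes b≤c = contradiction
      (trans (sym (rank-all (<⇒≤ a<c ∷ b≤c ∷ ≤-refl ∷ []))) (∷-injectiveˡ (∷-injectiveʳ (∷-injectiveʳ eq)))) λ ()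

  132≡red : ∀ {a b c} → a < c → c < b → red (a ∷ b ∷ c ∷ []) ≡ 1 ∷ 3 ∷ 2 ∷ []
  132≡red {a} {b} {c} a<c c<b = cong₂ _∷_ rank-a (cong₂ _∷_ rank-b (cong [_] rank-c))
    where
    a<b = <-trans a<c c<b
    rank-a : rank a (a ∷ b ∷ c ∷ []) ≡ 1
    rank-a = trans (rank-accept {a} (b ∷ c ∷ []) ≤-refl) (cong suc (rank-none {a} (a<b ∷ a<c ∷ [])))
    rank-b : rank b (a ∷ b ∷ c ∷ []) ≡ 3
    rank-b = rank-all (<⇒≤ a<b ∷ ≤-refl ∷ <⇒≤ c<b ∷ [])
    rank-c : rank c (a ∷ b ∷ c ∷ []) ≡ 2
    rank-c = trans (rank-accept (b ∷ c ∷ []) (<⇒≤ a<c)) (cong suc (trans (rank-reject [ c ] c<b) (rank-all {c} (≤-refl ∷ []))))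

  avoids⇒free : ∀ {w} → Avoids (1 ∷ 3 ∷ 2 ∷ []) w → 132-free w
  avoids⇒free av s a<c c<b = av s (132≡red a<c c<b)

  free⇒avoids : ∀ {w} → 132-free w → Avoids (1 ∷ 3 ∷ 2 ∷ []) w
  free⇒avoids free {a ∷ b ∷ c ∷ []} s eq = uncurry (free s) (red≡132 eq)
  free⇒avoids free {_ ∷ _ ∷ _ ∷ _ ∷ _} s ()

  -- The enumerated 132-avoiders, characterised by `Valid`.

  record Valid (w : Word) : Set where
    constructor valid
    field
      positive : All (1 ≤_) w
      bounded  : All (_≤ length w) w
      unique   : Unique w
      free     : 132-free w

  ∈-words⁺ : ∀ {alphabet w} → All (_∈ alphabet) w → w ∈ words alphabet (length w)
  ∈-words⁺ []         = here refl
  ∈-words⁺ (x∈ ∷ w∈) = ∈-cartesianProductWith⁺ _∷_ x∈ (∈-words⁺ w∈)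

  ∈-words⁻ : ∀ alphabet k {w} → w ∈ words alphabet k → length w ≡ k × All (_∈ alphabet) w
  ∈-words⁻ alphabet zero    (here refl) = refl , []
  ∈-words⁻ alphabet (suc k) w∈ with ∈-cartesianProductWith⁻ _∷_ alphabet (words alphabet k) w∈
  ... | _ , _ , x∈ , v∈ , refl = let eq , all = ∈-words⁻ alphabet k v∈ in cong suc eq , x∈ ∷ all

  words-unique : ∀ {alphabet} k → Unique alphabet → Unique (words alphabet k)
  words-unique zero    _ = [] ∷ []
  words-unique (suc k) u = Uniqueₚ.cartesianProductWith⁺ _∷_ ∷-injective u (words-unique k u)

  ∈-interval⁺ : ∀ {n x} → 1 ≤ x → x ≤ n → x ∈ interval 1 n
  ∈-interval⁺ {x = suc x} _ x<n = ∈-applyUpTo⁺ suc x<n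

  ∈-interval⁻ : ∀ {n x} → x ∈ interval 1 n → 1 ≤ x × x ≤ n
  ∈-interval⁻ x∈ with ∈-applyUpTo⁻ suc x∈
  ... | _ , i<n , refl = s≤s z≤n , i<n

  Av : ℕ → List Word
  Av = 𝒮-avoiding (1 ∷ 3 ∷ 2 ∷ [])

  Av-unique : ∀ n → Unique (Av n)
  Av-unique n = Uniqueₚ.filter⁺ (avoids? (1 ∷ 3 ∷ 2 ∷ [])) (Uniqueₚ.filter⁺ unique?
    (words-unique n (Uniqueₚ.applyUpTo⁺₁ suc n (λ i<j _ → <⇒≢ i<j ∘ suc-injective))))

  ∈-Av⁺ : ∀ {w} → Valid w → w ∈ Av (length w)
  ∈-Av⁺ (valid pos bnd u free) = ∈-filter⁺ (avoids? _)
    (∈-filter⁺ unique? (∈-words⁺ (All.zipWith (uncurry ∈-interval⁺) (pos , bnd))) u) (free⇒avoids free)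

  ∈-Av⁻ : ∀ n {w} → w ∈ Av n → length w ≡ n × Valid w
  ∈-Av⁻ n w∈ with ∈-filter⁻ (avoids? (1 ∷ 3 ∷ 2 ∷ [])) {xs = 𝒮 n} w∈
  ... | w∈𝒮 , av with ∈-filter⁻ unique? {xs = words (interval 1 n) n} w∈𝒮
  ...   | w∈words , u with ∈-words⁻ (interval 1 n) n w∈words
  ...     | refl , all = refl , valid (All.map (proj₁ ∘ ∈-interval⁻) all) (All.map (proj₂ ∘ ∈-interval⁻) all) u (avoids⇒free av)

  Unique-resp-↭ : ∀ {xs ys : Word} → xs ↭ ys → Unique xs → Unique ys
  Unique-resp-↭ p = ↭ₛ.Unique-resp-↭ (setoid ℕ) (↭⇒↭ₛ p)

  strict : ∀ {n w} → n ∉ w → All (_≤ n) w → All (_< n) w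
  strict n∉w ≤n = All.tabulate λ x∈w → ≤∧≢⇒< (All.lookup ≤n x∈w) λ { refl → n∉w x∈w }

  -- Induction on the width of the interval: its top value occurs at most once among distinct
  -- letters, and without it the remaining letters fit into an interval narrower by one.
  pigeonhole : ∀ k lo {w} → Unique w → All (lo <_) w → All (_≤ lo + k) w → length w ≤ k
  pigeonhole zero    lo {[]}    _ _ _ = z≤n
  pigeonhole zero    lo {x ∷ w} _ (lo<x ∷ _) (x≤lo ∷ _) = contradiction (≤-trans x≤lo (≤-reflexive (+-identityʳ lo))) (<⇒≱ lo<x)
  pigeonhole (suc k) lo {w} u lo< ≤hi with (lo + suc k) ∈? w
  ... | no hi∉w = m≤n⇒m≤1+n (pigeonhole k lo u lo<
    (All.map (λ x<hi → ≤-pred (≤-trans x<hi (≤-reflexive (+-suc lo k)))) (strict hi∉w ≤hi)))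
  ... | yes hi∈w with ∈-∃++ hi∈w
  ...   | ys , zs , refl with ↭.shift (lo + suc k) ys zs
  ...     | p with Unique-resp-↭ p u | ↭.All-resp-↭ p lo< | ↭.All-resp-↭ p ≤hi
  ...       | u′@(_ ∷ u″) | _ ∷ lo<′ | _ ∷ ≤hi′ = ≤-trans (≤-reflexive (↭.↭-length p))
    (s≤s (pigeonhole k lo u″ lo<′ (All.map (λ x<hi → ≤-pred (≤-trans x<hi (≤-reflexive (+-suc lo k))))
      (strict (Uniqueₚ.Unique[x∷xs]⇒x∉xs u′) ≤hi′))))

  -- Gluing two avoiders around a new maximum.

  glue : Word → Word → Word
  glue l r = map (length r +_) l ++ suc (length l + length r) ∷ r

  length-glue : ∀ l r → length (glue l r) ≡ suc (length l + length r)
  length-glue l r = trans (length-++ (map (length r +_) l))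
    (trans (cong (_+ suc (length r)) (length-map _ l)) (+-suc (length l) (length r)))

  glue-peak : ∀ {l r} → Valid l → Valid r → Peak (map (length r +_) l) (suc (length l + length r)) r
  glue-peak {l} {r} vl vr = peak
    (Allₚ.map⁺ (All.map (λ x≤ → s≤s (≤-trans (+-monoʳ-≤ (length r) x≤) (≤-reflexive (+-comm (length r) (length l)))))
      (Valid.bounded vl)))
    (All.map (λ y≤ → s≤s (≤-trans y≤ (m≤n+m _ (length l)))) (Valid.bounded vr))
    (Allₚ.map⁺ (All.map (λ 1≤x → All.map
      (λ y≤ → ≤-trans (s≤s y≤) (≤-trans (≤-reflexive (+-comm 1 _)) (+-monoʳ-≤ (length r) 1≤x)))
      (Valid.bounded vr)) (Valid.positive vl)))

  ⊆-++⁻ : ∀ {a} {A : Set a} (xs : List A) {ys zs} → zs ⊆ xs ++ ys → ∃₂ λ us vs → zs ≡ us ++ vs × us ⊆ xs × vs ⊆ ys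
  ⊆-++⁻ []       s        = [] , _ , refl , [] , s
  ⊆-++⁻ (x ∷ xs) (_ ∷ʳ s) with ⊆-++⁻ xs s
  ... | us , vs , eq , s₁ , s₂ = us , vs , eq , _ ∷ʳ s₁ , s₂
  ⊆-++⁻ (x ∷ xs) (refl ∷ s) with ⊆-++⁻ xs s
  ... | us , vs , eq , s₁ , s₂ = x ∷ us , vs , cong (x ∷_) eq , refl ∷ s₁ , s₂

  ⊆-last : ∀ {a} {A : Set a} {b c p : A} {r} → b ∷ c ∷ [] ⊆ p ∷ r → c ∈ r
  ⊆-last (_ ∷ʳ s) = lookup s (there (here refl))
  ⊆-last (_ ∷ s)  = to∈ s

  -- Cases by the number of letters of an occurrence a b c that lie in `l`. If there are one or two,
  -- then c is in `r`, hence below a, or c is `p`, hence above b. If there are none and a is `p`,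
  -- then c is below a.
  132-free-peak : ∀ {l p r} → Peak l p r → 132-free l → 132-free r → 132-free (l ++ p ∷ r)
  132-free-peak {l} {p} {r} (peak l<p r<p cross) fl fr s a<c c<b with ⊆-++⁻ l s
  ... | [] , _ , refl , _ , (_ ∷ʳ s₂)   = fr s₂ a<c c<b
  ... | [] , _ , refl , _ , (refl ∷ s₂) = <-asym a<c (All.lookup r<p (lookup s₂ (there (here refl))))
  ... | _ ∷ [] , _ , refl , s₁ , s₂     = <-asym a<c (All.lookup (All.lookup cross (to∈ s₁)) (⊆-last s₂))
  ... | _ ∷ _ ∷ [] , _ , refl , s₁ , s₂ with to∈ s₂
  ...   | here refl = <-asym c<b (All.lookup l<p (lookup s₁ (there (here refl))))
  ...   | there c∈r = <-asym a<c (All.lookup (All.lookup cross (lookup s₁ (here refl))) c∈r)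
  132-free-peak {l} {p} {r} (peak l<p r<p cross) fl fr s a<c c<b | _ ∷ _ ∷ _ ∷ [] , [] , refl , s₁ , s₂ = fl s₁ a<c c<b

  132-free-⊆ : ∀ {v w} → v ⊆ w → 132-free w → 132-free v
  132-free-⊆ v⊆w free s = free (⊆-trans s v⊆w)

  132-free-map⁻ : ∀ k {w} → 132-free (map (k +_) w) → 132-free w
  132-free-map⁻ k free s a<c c<b = free (⊆.map⁺ (k +_) s) (+-monoʳ-< k a<c) (+-monoʳ-< k c<b)

  132-free-map⁺ : ∀ k {w} → 132-free w → 132-free (map (k +_) w)
  132-free-map⁺ k {w} free s = go (⊆-map⁻ w s)
    where
    ⊆-map⁻ : ∀ w {zs} → zs ⊆ map (k +_) w → ∃ λ us → zs ≡ map (k +_) us × us ⊆ w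
    ⊆-map⁻ []      []         = [] , refl , []
    ⊆-map⁻ (x ∷ w) (_ ∷ʳ s)   = let us , eq , s′ = ⊆-map⁻ w s in us , eq , x ∷ʳ s′
    ⊆-map⁻ (x ∷ w) (refl ∷ s) = let us , eq , s′ = ⊆-map⁻ w s in x ∷ us , cong (_ ∷_) eq , refl ∷ s′
    go : ∀ {a b c} → (∃ λ us → a ∷ b ∷ c ∷ [] ≡ map (k +_) us × us ⊆ w) → a < c → c < b → ⊥
    go (_ ∷ _ ∷ _ ∷ [] , refl , s′) a<c c<b = free s′ (+-cancelˡ-< k _ _ a<c) (+-cancelˡ-< k _ _ c<b)

  peak-unique : ∀ {l p r} → Peak l p r → Unique l → Unique r → Unique (l ++ p ∷ r)
  peak-unique (peak l<p r<p cross) ul ur = Uniqueₚ.++⁺ ul (All.map (λ y<p eq → <-irrefl (sym eq) y<p) r<p ∷ ur)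
    λ { (x∈l , here refl) → <-irrefl refl (All.lookup l<p x∈l)
      ; (x∈l , there x∈r) → <-irrefl refl (All.lookup (All.lookup cross x∈l) x∈r) }

  glue-valid : ∀ {l r} → Valid l → Valid r → Valid (glue l r)
  glue-valid {l} {r} vl@(valid pl bl ul fl) vr@(valid pr br ur fr) = valid
    (Allₚ.++⁺ (Allₚ.map⁺ (All.map (λ 1≤x → ≤-trans 1≤x (m≤n+m _ (length r))) pl)) (s≤s z≤n ∷ pr))
    (subst (λ k → All (_≤ k) (glue l r)) (sym (length-glue l r))
      (Allₚ.++⁺ (All.map <⇒≤ (Peak.left pk)) (≤-refl ∷ All.map <⇒≤ (Peak.right pk))))
    (peak-unique pk (Uniqueₚ.map⁺ (+-cancelˡ-≡ (length r) _ _) ul) ur)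
    (132-free-peak pk (132-free-map⁺ (length r) fl) fr)
    where pk = glue-peak vl vr

  -- Equal lengths give equal maxima, and the single occurrence of the maximum marks the cut. Equal
  -- right halves then give equal shifts of the left halves.
  glue-injective : ∀ {l r l′ r′} → Valid l → Valid r → Valid l′ → Valid r′ →
                   glue l r ≡ glue l′ r′ → l ≡ l′ × r ≡ r′
  glue-injective {l} {r} {l′} {r′} vl vr vl′ vr′ eq =
    map-injective (+-cancelˡ-≡ (length r) _ _) (trans (proj₁ eqs) (cong (λ v → map (length v +_) l′) (sym (proj₂ eqs)))) , proj₂ eqs
    where
    size : suc (length l + length r) ≡ suc (length l′ + length r′)
    size = trans (sym (length-glue l r)) (trans (cong length eq) (length-glue l′ r′))
    pk = glue-peak vl′ vr′
    eqs : map (length r +_) l ≡ map (length r′ +_) l′ × r ≡ r′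
    eqs = ++-∷-injective (map (length r′ +_) l′)
      (λ p∈ → <-irrefl refl (All.lookup (Peak.left pk) p∈)) (λ p∈ → <-irrefl refl (All.lookup (Peak.right pk) p∈))
      (trans (cong (λ k → map (length r +_) l ++ k ∷ r) (sym size)) eq)

  Unique-++⁻ : ∀ {a} {A : Set a} (xs : List A) {ys} → Unique (xs ++ ys) →
               Unique xs × Unique ys × (∀ {x y} → x ∈ xs → y ∈ ys → x ≢ y)
  Unique-++⁻ []       u         = [] , u , λ ()
  Unique-++⁻ (x ∷ xs) (x∉ ∷ u) with Unique-++⁻ xs u
  ... | uxs , uys , disj = Allₚ.++⁻ˡ xs x∉ ∷ uxs , uys ,
    λ { (here refl) y∈ys → All.lookup (Allₚ.++⁻ʳ xs x∉) y∈ys ; (there x∈xs) → disj x∈xs }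

  -- Both halves occupy full intervals by counting: a letter y right of the maximum lies below
  -- all letters on the left, and a letter x on the left lies above all letters on the right.
  glue-surjective : ∀ {n w} → length w ≡ suc n → Valid w →
                    ∃₂ λ l r → Valid l × Valid r × length l + length r ≡ n × w ≡ glue l r
  glue-surjective {n} {w} len (valid pos bnd u free) with suc n ∈? w
  -- Without the value `suc n`, the `suc n` distinct letters would all lie among 1, ..., n.
  ... | no n∉w = contradiction (≤-trans (≤-reflexive (sym len)) (pigeonhole n 0 u pos
    (All.map ≤-pred (strict n∉w (subst (λ k → All (_≤ k) w) len bnd))))) 1+n≰n
  ... | yes n∈w with ∈-∃++ n∈w
  ...   | s , r , refl with ↭.shift (suc n) s r
  ...     | p with Unique-resp-↭ p u | ↭.All-resp-↭ p pos
                      | ↭.All-resp-↭ p (subst (λ k → All (_≤ k) (s ++ suc n ∷ r)) len bnd)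
  ...       | u′@(_ ∷ usr) | _ ∷ possr | _ ∷ bsr =
    l , r , vl , vr , size , sym (cong₂ _++_ s≡ (cong (λ k → suc k ∷ r) size))
    where
    k = length r
    l = map (_∸ k) s

    ≤n : All (_≤ n) (s ++ r)
    ≤n = All.map ≤-pred (strict (Uniqueₚ.Unique[x∷xs]⇒x∉xs u′) bsr)

    us : Unique s
    us = proj₁ (Unique-++⁻ s usr)

    ur : Unique r
    ur = proj₁ (proj₂ (Unique-++⁻ s usr))

    s+r≡n : length s + length r ≡ n
    s+r≡n = suc-injective (trans (sym (+-suc (length s) (length r))) (trans (sym (length-++ s)) len))

    cross : ∀ {x y} → x ∈ s → y ∈ r → y < x
    cross {x} {y} x∈s y∈r with y <? x
    ... | yes y<x = y<x
    -- Otherwise `x`, the maximum and `y` would form an occurrence of 132.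
    ... | no  y≮x = ⊥-elim (free (⊆.++⁺ (from∈ x∈s) (refl ∷ from∈ y∈r))
      (≤∧≢⇒< (≮⇒≥ y≮x) (proj₂ (proj₂ (Unique-++⁻ s usr)) x∈s y∈r)) (s≤s (All.lookup (Allₚ.++⁻ʳ s ≤n) y∈r)))

    r≤k : ∀ {y} → y ∈ r → y ≤ k
    r≤k {y} y∈r = +-cancelˡ-≤ (length s) y k (≤-trans (+-monoˡ-≤ y s≤n∸y) (≤-reflexive (trans (m∸n+n≡m y≤n) (sym s+r≡n))))
      where
      y≤n : y ≤ n
      y≤n = All.lookup (Allₚ.++⁻ʳ s ≤n) y∈r
      s≤n∸y : length s ≤ n ∸ y
      s≤n∸y = pigeonhole (n ∸ y) y us (All.tabulate λ x∈s → cross x∈s y∈r)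
        (All.map (λ x≤n → ≤-trans x≤n (≤-reflexive (sym (m+[n∸m]≡n y≤n)))) (Allₚ.++⁻ˡ s ≤n))

    k<s : ∀ {x} → x ∈ s → k < x
    k<s {zero}  x∈s = contradiction (All.lookup (Allₚ.++⁻ˡ s possr) x∈s) λ ()
    k<s {suc x} x∈s = s≤s (pigeonhole x 0 ur (Allₚ.++⁻ʳ s possr) (All.tabulate λ y∈r → ≤-pred (cross x∈s y∈r)))

    s≡ : map (k +_) l ≡ s
    s≡ = trans (sym (map-∘ s)) (map-id-local (All.tabulate λ x∈s → m+[n∸m]≡n (<⇒≤ (k<s x∈s))))

    size : length l + length r ≡ n
    size = trans (cong (_+ length r) (length-map _ s)) s+r≡n

    vl : Valid l
    vl = valid
      (Allₚ.map⁺ (All.tabulate λ x∈s → m<n⇒0<n∸m (k<s x∈s)))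
      (Allₚ.map⁺ (All.map
        (λ x≤n → ≤-trans (∸-monoˡ-≤ k x≤n) (≤-reflexive (trans (cong (_∸ k) (sym size)) (m+n∸n≡m (length l) k))))
        (Allₚ.++⁻ˡ s ≤n)))
      (Uniqueₚ.map⁻ (subst Unique (sym s≡) us))
      (132-free-map⁻ k (subst 132-free (sym s≡) (132-free-⊆ (⊆.++⁺ʳ _ ⊆-refl) free)))

    vr : Valid r
    vr = valid (Allₚ.++⁻ʳ s possr) (All.tabulate r≤k) ur (132-free-⊆ (⊆.++⁺ˡ s (_ ∷ʳ ⊆-refl)) free)

  -- Enumeration of the pairs of halves.

  splitsAt : ∀ n → Fin (suc n) → List (Word × Word)
  splitsAt n i = cartesianProduct (Av (toℕ i)) (Av (n ∸ toℕ i))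

  -- Indexed by `Fin (suc n)` exactly as the product of series, so that summing a product of weights
  -- over it gives a coefficient of that product.
  splits : ℕ → List (Word × Word)
  splits n = concat (tabulate (splitsAt n))

  ∈-splits⁺ : ∀ {l r} → Valid l → Valid r → (l , r) ∈ splits (length l + length r)
  ∈-splits⁺ {l} {r} vl vr = ∈-concat⁺′ (∈-cartesianProduct⁺
      (subst (λ k → l ∈ Av k) (sym i≡) (∈-Av⁺ vl))
      (subst (λ k → r ∈ Av k) (sym (trans (cong (n ∸_) i≡) (m+n∸m≡n (length l) (length r)))) (∈-Av⁺ vr)))
    (∈-tabulate⁺ {f = splitsAt n} i)
    where
    n = length l + length r
    l≤n : length l < suc n
    l≤n = s≤s (m≤m+n (length l) (length r))
    i : Fin (suc n)
    i = fromℕ< l≤n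
    i≡ : toℕ i ≡ length l
    i≡ = Finₚ.toℕ-fromℕ< l≤n

  ∈-splits⁻ : ∀ n {l r} → (l , r) ∈ splits n → Valid l × Valid r × length l + length r ≡ n
  ∈-splits⁻ n {l} {r} lr∈ with ∈-concat⁻′ (tabulate (splitsAt n)) lr∈
  ... | _ , lr∈i , i∈ with ∈-tabulate⁻ {f = splitsAt n} i∈
  ...   | i , refl with ∈-cartesianProduct⁻ (Av (toℕ i)) (Av (n ∸ toℕ i)) lr∈i
  ...     | l∈ , r∈ with ∈-Av⁻ (toℕ i) l∈ | ∈-Av⁻ (n ∸ toℕ i) r∈
  ...       | l≡ , vl | r≡ , vr = vl , vr , trans (cong₂ _+_ l≡ r≡) (m+[n∸m]≡n (≤-pred (Finₚ.toℕ<n i)))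

  splits-unique : ∀ n → Unique (splits n)
  splits-unique n = Uniqueₚ.concat⁺
    (Allₚ.tabulate⁺ λ i → Uniqueₚ.cartesianProduct⁺ (Av-unique (toℕ i)) (Av-unique (n ∸ toℕ i)))
    (AllPairsₚ.tabulate⁺ λ {i} {j} i≢j {_} (x∈i , x∈j) → i≢j (Finₚ.toℕ-injective (trans (sym (size i x∈i)) (size j x∈j))))
    where
    size : ∀ i {lr} → lr ∈ splitsAt n i → length (proj₁ lr) ≡ toℕ i
    size i lr∈ = proj₁ (∈-Av⁻ (toℕ i) (proj₁ (∈-cartesianProduct⁻ (Av (toℕ i)) (Av (n ∸ toℕ i)) lr∈)))

  -- Injectivity is asked for members of the list only, since `glue-injective` assumes valid words.
  Unique-map-∈ : ∀ {a b} {A : Set a} {B : Set b} (f : A → B) {xs} →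
                 (∀ {x y} → x ∈ xs → y ∈ xs → f x ≡ f y → x ≡ y) → Unique xs → Unique (map f xs)
  Unique-map-∈ f inj []       = []
  Unique-map-∈ f inj (x∉ ∷ u) =
    Allₚ.map⁺ (All.tabulate λ y∈ fx≡fy → All.lookup x∉ y∈ (inj (here refl) (there y∈) fx≡fy))
    ∷ Unique-map-∈ f (λ x∈ y∈ → inj (there x∈) (there y∈)) u

  -- Both lists are free of repetitions and, by the decomposition at the maximum, have the same
  -- members. Equality up to order is enough for sums over them.
  Av-suc-↭ : ∀ n → Av (suc n) ↭ map (uncurry glue) (splits n)
  Av-suc-↭ n = ∼bag⇒↭ (unique∧set⇒bag (Av-unique (suc n))
    (Unique-map-∈ (uncurry glue) inj (splits-unique n)) (mk⇔ to from))
    where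
    inj : ∀ {x y} → x ∈ splits n → y ∈ splits n → uncurry glue x ≡ uncurry glue y → x ≡ y
    inj x∈ y∈ eq with ∈-splits⁻ n x∈ | ∈-splits⁻ n y∈
    ... | vl , vr , _ | vl′ , vr′ , _ = let l≡ , r≡ = glue-injective vl vr vl′ vr′ eq in cong₂ _,_ l≡ r≡

    to : ∀ {w} → w ∈ Av (suc n) → w ∈ map (uncurry glue) (splits n)
    to w∈ with ∈-Av⁻ (suc n) w∈
    ... | len , v with glue-surjective len v
    ...   | l , r , vl , vr , refl , refl = ∈-map⁺ (uncurry glue) (∈-splits⁺ vl vr)

    from : ∀ {w} → w ∈ map (uncurry glue) (splits n) → w ∈ Av (suc n)
    from w∈ with ∈-map⁻ (uncurry glue) w∈
    ... | (l , r) , lr∈ , refl with ∈-splits⁻ n lr∈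
    ...   | vl , vr , refl = subst (λ k → glue l r ∈ Av k) (length-glue l r) (∈-Av⁺ (glue-valid vl vr))

-- Generating functions of weighted 132-avoiders.

module GeneratingFunctions (P : CommutativeRing c ℓ) (X : CommutativeRing.Carrier P) where
  open Combinatorics
  open ≡ using (refl)
  open CommutativeRing P renaming (refl to ≈-refl; sym to ≈-sym; trans to ≈-trans) hiding (zero)
  open PowerSeriesRing P using (𝕥-⊛-zero; 𝕥-⊛-suc; constant-⊛; fixed-point-unique)
  private
    module 𝕊 = CommutativeRing (PowerSeriesRing.commutativeRing P)
    module χℕ = Indicator ℕₚ.+-*-commutativeSemiring
  open Indicator commutativeSemiring
  open Exp semiring using (_^_; ^-homo-*)
  open Sum +-commutativeMonoid using (sum; sum-cong-≋)
  open import Relation.Binary.Reasoning.Setoid setoid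
  open SemiringSolver commutativeSemiring using (solve; _:+_; _:*_; _:=_; con)
  open PowerSeries rawRing using (Series; constant) renaming (indeterminate to 𝕥)

  ∑ : ∀ {a} {A : Set a} → (A → Carrier) → List A → Carrier
  ∑ φ xs = foldr _+_ 0# (map φ xs)

  module _ {a} {A : Set a} where
    ∑-cong : ∀ {φ ψ : A → Carrier} xs → (∀ {x} → x ∈ xs → φ x ≈ ψ x) → ∑ φ xs ≈ ∑ ψ xs
    ∑-cong []       _ = ≈-refl
    ∑-cong (x ∷ xs) h = +-cong (h (here refl)) (∑-cong xs (h ∘ there))

    ∑-zero : ∀ (xs : List A) → ∑ (λ _ → 0#) xs ≈ 0#
    ∑-zero []       = ≈-refl
    ∑-zero (x ∷ xs) = ≈-trans (+-identityˡ _) (∑-zero xs)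

    ∑-+ : ∀ (φ ψ : A → Carrier) xs → ∑ (λ x → φ x + ψ x) xs ≈ ∑ φ xs + ∑ ψ xs
    ∑-+ φ ψ []       = ≈-sym (+-identityˡ _)
    ∑-+ φ ψ (x ∷ xs) = ≈-trans (+-congˡ (∑-+ φ ψ xs))
      (solve 4 (λ a b c d → (a :+ b) :+ (c :+ d) := (a :+ c) :+ (b :+ d)) ≈-refl _ _ _ _)

    ∑-*ˡ : ∀ k (φ : A → Carrier) xs → ∑ (λ x → k * φ x) xs ≈ k * ∑ φ xs
    ∑-*ˡ k φ []       = ≈-sym (zeroʳ k)
    ∑-*ˡ k φ (x ∷ xs) = ≈-trans (+-congˡ (∑-*ˡ k φ xs)) (≈-sym (distribˡ k _ _))

    ∑-++ : ∀ (φ : A → Carrier) xs ys → ∑ φ (xs ++ ys) ≈ ∑ φ xs + ∑ φ ys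
    ∑-++ φ []       ys = ≈-sym (+-identityˡ _)
    ∑-++ φ (x ∷ xs) ys = ≈-trans (+-congˡ (∑-++ φ xs ys)) (≈-sym (+-assoc _ _ _))

    ∑-↭ : ∀ (φ : A → Carrier) {xs ys} → xs ↭ ys → ∑ φ xs ≈ ∑ φ ys
    ∑-↭ φ Permutation.refl         = ≈-refl
    ∑-↭ φ (Permutation.prep x p)   = +-congˡ (∑-↭ φ p)
    ∑-↭ φ (Permutation.swap x y p) = ≈-trans (+-congˡ (+-congˡ (∑-↭ φ p)))
      (solve 3 (λ a b c → a :+ (b :+ c) := b :+ (a :+ c)) ≈-refl _ _ _)
    ∑-↭ φ (Permutation.trans p q)  = ≈-trans (∑-↭ φ p) (∑-↭ φ q)

    ∑-concat-tabulate : ∀ (φ : A → Carrier) {n} (f : Fin n → List A) → ∑ φ (concat (tabulate f)) ≈ sum (λ i → ∑ φ (f i))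
    ∑-concat-tabulate φ {zero}  f = ≈-refl
    ∑-concat-tabulate φ {suc n} f = ≈-trans (∑-++ φ (f zero) _) (+-congˡ (∑-concat-tabulate φ (f ∘ suc)))

  ∑-map : ∀ {a b} {A : Set a} {B : Set b} (φ : B → Carrier) (f : A → B) xs → ∑ φ (map f xs) ≡ ∑ (φ ∘ f) xs
  ∑-map φ f xs = ≡.cong (foldr _+_ 0#) (≡.sym (map-∘ xs))

  ∑-cartesianProduct : ∀ {a b} {A : Set a} {B : Set b} (α : A → Carrier) (β : B → Carrier) xs ys →
                       ∑ (λ (x , y) → α x * β y) (cartesianProduct xs ys) ≈ ∑ α xs * ∑ β ys
  ∑-cartesianProduct α β []       ys = ≈-sym (zeroˡ _)
  ∑-cartesianProduct α β (x ∷ xs) ys = begin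
    ∑ φ (map (x ,_) ys ++ cartesianProduct xs ys)          ≈⟨ ∑-++ φ (map (x ,_) ys) _ ⟩
    ∑ φ (map (x ,_) ys) + ∑ φ (cartesianProduct xs ys)
      ≈⟨ +-cong (≈-trans (reflexive (∑-map φ (x ,_) ys)) (∑-*ˡ (α x) β ys)) (∑-cartesianProduct α β xs ys) ⟩
    α x * ∑ β ys + ∑ α xs * ∑ β ys                         ≈⟨ distribʳ _ _ _ ⟨
    (α x + ∑ α xs) * ∑ β ys                                ∎
    where φ = λ (x , y) → α x * β y

  -- For the weight `X ^ mch π w` this unfolds to the definition of `B`.
  gf : (Word → Carrier) → Series
  gf φ n = ∑ φ (Av n)

  gf-cong : ∀ {φ ψ} → (∀ w → φ w ≈ ψ w) → gf φ 𝕊.≈ gf ψ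
  gf-cong h n = ∑-cong (Av n) (λ {w} _ → h w)

  gf-+ : ∀ φ ψ → gf (λ w → φ w + ψ w) 𝕊.≈ (gf φ 𝕊.+ gf ψ)
  gf-+ φ ψ n = ∑-+ φ ψ (Av n)

  gf-*ˡ : ∀ k φ → gf (λ w → k * φ w) 𝕊.≈ (constant k 𝕊.* gf φ)
  gf-*ˡ k φ n = ≈-trans (∑-*ˡ k φ (Av n)) (≈-sym (constant-⊛ k (gf φ) n))

  gf-suc : ∀ φ n → gf φ (suc n) ≈ ∑ (φ ∘ uncurry glue) (splits n)
  gf-suc φ n = ≈-trans (∑-↭ φ (Av-suc-↭ n)) (reflexive (∑-map φ (uncurry glue) (splits n)))

  ∑-splits : ∀ α β n → ∑ (λ (l , r) → α l * β r) (splits n) ≈ (gf α 𝕊.* gf β) n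
  ∑-splits α β n = ≈-trans (∑-concat-tabulate _ (splitsAt n))
    (sum-cong-≋ {suc n} (λ i → ∑-cartesianProduct α β (Av (toℕ i)) (Av (n ∸ toℕ i))))

  -- Turns a recursion for a weight along `glue` into a functional equation: sums over pairs of
  -- halves become products of series, and the factor 𝕥 accounts for the maximum. Two products
  -- suffice for all the recursions below.
  gf-glue : ∀ φ α β α′ β′ → φ [] ≈ 0# →
            (∀ {l r} → Valid l → Valid r → φ (glue l r) ≈ α l * β r + α′ l * β′ r) →
            gf φ 𝕊.≈ (𝕥 𝕊.* (gf α 𝕊.* gf β 𝕊.+ gf α′ 𝕊.* gf β′))
  gf-glue φ α β α′ β′ φ[] h zero    = ≈-trans (+-identityʳ _) (≈-trans φ[] (≈-sym (𝕥-⊛-zero (gf α 𝕊.* gf β 𝕊.+ gf α′ 𝕊.* gf β′))))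
  gf-glue φ α β α′ β′ φ[] h (suc n) = begin
    gf φ (suc n)                                                ≈⟨ gf-suc φ n ⟩
    ∑ (φ ∘ uncurry glue) (splits n)
      ≈⟨ ∑-cong (splits n) (λ lr∈ → let vl , vr , _ = ∈-splits⁻ n lr∈ in h vl vr) ⟩
    ∑ (λ (l , r) → α l * β r + α′ l * β′ r) (splits n)          ≈⟨ ∑-+ _ _ (splits n) ⟩
    ∑ (λ (l , r) → α l * β r) (splits n) + ∑ (λ (l , r) → α′ l * β′ r) (splits n)
      ≈⟨ +-cong (∑-splits α β n) (∑-splits α′ β′ n) ⟩
    (gf α 𝕊.* gf β) n + (gf α′ 𝕊.* gf β′) n
      ≈⟨ 𝕥-⊛-suc (gf α 𝕊.* gf β 𝕊.+ gf α′ 𝕊.* gf β′) n ⟨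
    (𝕥 𝕊.* (gf α 𝕊.* gf β 𝕊.+ gf α′ 𝕊.* gf β′)) (suc n) ∎

  gf-zero : gf (λ _ → 0#) 𝕊.≈ 𝕊.0#
  gf-zero n = ∑-zero (Av n)

  gf-empty : gf (χ ∘ empty?) 𝕊.≈ 𝕊.1#
  gf-empty zero    = +-identityʳ _
  gf-empty (suc n) = ≈-trans
    (∑-cong (Av (suc n)) λ {w} w∈ → χ-no (empty? w) λ { refl → contradiction (proj₁ (∈-Av⁻ (suc n) w∈)) λ () })
    (∑-zero (Av (suc n)))

  -- Weights and their recursions along `glue`.

  -- Here a = c + 2 and m = c + j + 3.
  module Weights (c j : ℕ) where
    π : Word
    π = map suc (δ c j) ++ (3 ℕ.+ (c ℕ.+ j)) ∷ [ 1 ]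

    u : Word → Carrier
    u w = X ^ mch π w

    y : Carrier
    y = X + (- 1#)

    ends : ℕ → Word → Carrier
    ends i w = χ (endsWith? (δ c i) w) * u w

    -- The weight of a left half whose right half is nonempty: if it ends with `δ c j`, the maximum
    -- completes one more match, and the extra factor `X` is written as `1 + y`.
    v : Word → Carrier
    v w = u w + y * ends j w

    increasing : ℕ → Word → Carrier
    increasing i w = χ (≡-dec ℕₚ._≟_ (red w) (applyUpTo suc i)) * u w

    empty nonempty : Word → Carrier
    empty w = χ (empty? w)
    nonempty w = χ (¬? (empty? w)) * u w

    ¬starts-[] : ¬ Starts π []
    ¬starts-[] st = ℕₚ.<⇒≱ (s≤s z≤n) (ℕₚ.≤-trans (ℕₚ.m≤n+m 2 (length (map suc (δ c j))))
      (ℕₚ.≤-trans (ℕₚ.≤-reflexive (≡.sym (length-++ (map suc (δ c j))))) (starts-length π [] st)))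

    u-[] : u [] ≈ 1#
    u-[] = reflexive (≡.cong (X ^_) (≡.trans (mch-[] π) (χℕ.χ-no (starts? π []) ¬starts-[])))

    mch-glue : ∀ {l r} → Valid l → Valid r →
               mch π (glue l r) ≡ (mch π l ℕ.+ mch π r) ℕ.+ χℕ.χ (endsWith? (δ c j) l) ℕ.* χℕ.χ (¬? (empty? r))
    mch-glue {l} {r} vl vr = ≡.trans (mch-peak (γ-peaked c j) (glue-peak vl vr))
      (≡.cong₂ (λ m e → (m ℕ.+ mch π r) ℕ.+ e ℕ.* χℕ.χ (¬? (empty? r))) (mch-shift π (length r) l)
        (χℕ.χ-⇔ (endsWith? (δ c j) (map (length r ℕ.+_) l)) (endsWith? (δ c j) l)
          (endsWith-shift⁻ (length r) l) (endsWith-shift⁺ (length r) l)))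

    X^χ : ∀ {p} {Q : Set p} (Q? : Dec Q) → X ^ χℕ.χ Q? ≈ 1# + y * χ Q?
    X^χ (yes _) = ≈-trans (*-identityʳ X) (≈-sym (begin
      1# + (X + - 1#) * 1#   ≈⟨ +-congˡ (*-identityʳ _) ⟩
      1# + (X + - 1#)        ≈⟨ solve 3 (λ a b c → a :+ (b :+ c) := b :+ (a :+ c)) ≈-refl _ _ _ ⟩
      X + (1# + - 1#)        ≈⟨ +-congˡ (-‿inverseʳ 1#) ⟩
      X + 0#                 ≈⟨ +-identityʳ X ⟩
      X                      ∎))
    X^χ (no _)  = ≈-sym (≈-trans (+-congˡ (zeroʳ y)) (+-identityʳ _))

    -- A match through the maximum needs a letter after it, so none arises when the right half is
    -- empty.
    u-glue-[] : ∀ {l} → Valid l → Valid [] → u (glue l []) ≈ u l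
    u-glue-[] {l} vl v[] = reflexive (≡.cong (X ^_) (≡.trans (mch-glue vl v[]) (≡.trans
      (≡.cong₂ ℕ._+_ (≡.trans (≡.cong (mch π l ℕ.+_) (≡.trans (mch-[] π) (χℕ.χ-no (starts? π []) ¬starts-[]))) (ℕₚ.+-identityʳ _))
        (ℕₚ.*-zeroʳ (χℕ.χ (endsWith? (δ c j) l)))) (ℕₚ.+-identityʳ _))))

    u-glue-∷ : ∀ {l x r} → Valid l → Valid (x ∷ r) → u (glue l (x ∷ r)) ≈ v l * u (x ∷ r)
    u-glue-∷ {l} {x} {r} vl vr = begin
      X ^ mch π (glue l (x ∷ r))
        ≡⟨ ≡.cong (X ^_) (≡.trans (mch-glue vl vr) (≡.cong (λ k → mch π l ℕ.+ mch π (x ∷ r) ℕ.+ k) (ℕₚ.*-identityʳ _))) ⟩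
      X ^ (mch π l ℕ.+ mch π (x ∷ r) ℕ.+ χℕ.χ E?)   ≈⟨ ^-homo-* X (mch π l ℕ.+ mch π (x ∷ r)) _ ⟩
      X ^ (mch π l ℕ.+ mch π (x ∷ r)) * X ^ χℕ.χ E? ≈⟨ *-cong (^-homo-* X (mch π l) _) (X^χ E?) ⟩
      u l * u (x ∷ r) * (1# + y * χ E?)
        ≈⟨ solve 4 (λ a b y e → a :* b :* (con 1 :+ y :* e) := (a :+ y :* (e :* a)) :* b) ≈-refl (u l) (u (x ∷ r)) y (χ E?) ⟩
      v l * u (x ∷ r)                               ∎
      where E? = endsWith? (δ c j) l

    u≈ : ∀ w → u w ≈ empty w + nonempty w
    u≈ []      = ≈-trans u-[] (≈-sym (≈-trans (+-congˡ (zeroˡ _)) (+-identityʳ _)))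
    u≈ (x ∷ w) = ≈-sym (≈-trans (+-identityˡ _) (*-identityˡ _))

    glue-nonempty : ∀ l r → glue l r ≢ []
    glue-nonempty []      r ()
    glue-nonempty (_ ∷ _) r ()

    -- The first product is the case of an empty right half, the second that of a nonempty one; in
    -- each case the other product vanishes.
    nonempty-glue : ∀ {l r} → Valid l → Valid r → nonempty (glue l r) ≈ u l * empty r + v l * nonempty r
    nonempty-glue {l} {r} vl vr = ≈-trans (*-congʳ (χ-yes (¬? (empty? (glue l r))) (glue-nonempty l r)))
      (≈-trans (*-identityˡ _) (step r vr))
      where
      step : ∀ r → Valid r → u (glue l r) ≈ u l * empty r + v l * nonempty r
      step []      vr = ≈-trans (u-glue-[] vl vr) (solve 3 (λ a b d → a := a :* con 1 :+ b :* (con 0 :* d)) ≈-refl (u l) (v l) (u []))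
      step (x ∷ r) vr = ≈-trans (u-glue-∷ vl vr) (solve 3 (λ a b d → b :* d := a :* con 0 :+ b :* (con 1 :* d)) ≈-refl (u l) (v l) (u (x ∷ r)))

    ends-[] : ∀ i → ends i [] ≈ 0#
    ends-[] i = ≈-trans (*-congʳ (χ-no (endsWith? (δ c i) []) (¬endsWith-[] {c} {i}))) (zeroˡ _)

    -- The maximum of `δ c (suc i)` is its last letter. So a match containing the new maximum forces
    -- `r` to be empty and leaves a suffix of `l` matching `δ c i`; any other match lies in `r`.
    ends-suc-glue : ∀ i {l r} → Valid l → Valid r → ends (suc i) (glue l r) ≈ ends i l * empty r + v l * ends (suc i) r
    ends-suc-glue i {l} {[]} vl vr = begin
      χ (endsWith? (δ c (suc i)) (glue l [])) * u (glue l [])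
        ≈⟨ *-cong (χ-⇔ (endsWith? (δ c (suc i)) (glue l [])) (endsWith? (δ c i) l) to from) (u-glue-[] vl vr) ⟩
      ends i l                                         ≈⟨ solve 2 (λ a b → a := a :* con 1 :+ b :* con 0) ≈-refl (ends i l) (v l) ⟩
      ends i l * 1# + v l * 0#                         ≈⟨ +-congˡ (*-congˡ (ends-[] (suc i))) ⟨
      ends i l * 1# + v l * ends (suc i) []            ∎
      where
      pk = glue-peak vl vr
      to : EndsWith (δ c (suc i)) (glue l []) → EndsWith (δ c i) l
      to e with endsWith-peak⁻ (δ-suc-peaked c i) pk e
      ... | inj₁ (e′ , _) = endsWith-shift⁻ 0 l (Any.map (≡.trans (≡.sym (map-id _))) e′)
      ... | inj₂ e′       = contradiction e′ (¬endsWith-[] {c} {suc i})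
      from : EndsWith (δ c i) l → EndsWith (δ c (suc i)) (glue l [])
      from e = endsWith-peak⁺ (δ-suc-peaked c i) pk (inj₁ (Any.map (≡.trans (map-id _)) (endsWith-shift⁺ 0 l e) , refl))
    ends-suc-glue i {l} {r@(x ∷ r′)} vl vr = begin
      χ (endsWith? (δ c (suc i)) (glue l r)) * u (glue l r)
        ≈⟨ *-cong (χ-⇔ (endsWith? (δ c (suc i)) (glue l r)) (endsWith? (δ c (suc i)) r) to
             (endsWith-peak⁺ (δ-suc-peaked c i) pk ∘ inj₂)) (u-glue-∷ vl vr) ⟩
      χ (endsWith? (δ c (suc i)) r) * (v l * u r)
        ≈⟨ solve 4 (λ a b e d → e :* (b :* d) := a :* con 0 :+ b :* (e :* d)) ≈-refl (ends i l) (v l) _ (u r) ⟩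
      ends i l * 0# + v l * ends (suc i) r             ∎
      where
      pk = glue-peak vl vr
      to : EndsWith (δ c (suc i)) (glue l r) → EndsWith (δ c (suc i)) r
      to e with endsWith-peak⁻ (δ-suc-peaked c i) pk e
      ... | inj₂ e′ = e′

    -- The maximum of `δ c 0` is its first letter. So a matching suffix either starts at the new
    -- maximum, with `r` being 1 2 ⋯ c up to reduction, or lies in `r`.
    ends-zero-glue : 1 ≤ c → ∀ {l r} → Valid l → Valid r → ends 0 (glue l r) ≈ v l * increasing c r + v l * ends 0 r
    ends-zero-glue 1≤c {l} {r} vl vr = begin
      χ (endsWith? (δ c 0) (glue l r)) * u (glue l r)
        ≈⟨ *-congʳ (χ-⊎ (endsWith? (δ c 0) (glue l r)) I? E? to from₁ from₂ disjoint) ⟩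
      (χ I? + χ E?) * u (glue l r)                     ≈⟨ step r vr ⟩
      v l * increasing c r + v l * ends 0 r            ∎
      where
      I? = ≡-dec ℕₚ._≟_ (red r) (applyUpTo suc c)
      E? = endsWith? (δ c 0) r
      pk = glue-peak vl vr
      to : EndsWith (δ c 0) (glue l r) → red r ≡ applyUpTo suc c ⊎ EndsWith (δ c 0) r
      to e with endsWith-peak⁻ (δ-zero-peaked c) pk e
      ... | inj₁ (_ , r≡) = inj₁ r≡
      ... | inj₂ e′       = inj₂ e′
      -- Nothing precedes the maximum in `δ c 0`, so the left half contributes its empty suffix.
      []∈tails : ∀ s → Any (λ w → map (length r ℕ.+_) (red w) ≡ []) (tails s)
      []∈tails []      = here refl
      []∈tails (_ ∷ s) = there ([]∈tails s)
      from₁ : red r ≡ applyUpTo suc c → EndsWith (δ c 0) (glue l r)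
      from₁ r≡ = endsWith-peak⁺ (δ-zero-peaked c) pk (inj₁ ([]∈tails (map (length r ℕ.+_) l) , r≡))
      from₂ : EndsWith (δ c 0) r → EndsWith (δ c 0) (glue l r)
      from₂ = endsWith-peak⁺ (δ-zero-peaked c) pk ∘ inj₂
      disjoint : red r ≡ applyUpTo suc c → ¬ EndsWith (δ c 0) r
      disjoint r≡ e = ℕₚ.1+n≰n (ℕₚ.≤-trans (endsWith-length r e)
        (ℕₚ.≤-reflexive (≡.trans (≡.sym (length-red r)) (≡.cong length r≡))))
      step : ∀ r → Valid r →
             (χ (≡-dec ℕₚ._≟_ (red r) (applyUpTo suc c)) + χ (endsWith? (δ c 0) r)) * u (glue l r) ≈
             v l * increasing c r + v l * ends 0 r
      step [] vr = begin
        (χ (≡-dec ℕₚ._≟_ [] (applyUpTo suc c)) + χ (endsWith? (δ c 0) [])) * u (glue l [])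
          ≈⟨ *-congʳ (+-cong no-increasing (χ-no (endsWith? (δ c 0) []) (¬endsWith-[] {c} {0}))) ⟩
        (0# + 0#) * u (glue l [])
          ≈⟨ solve 3 (λ a b d → (con 0 :+ con 0) :* a := b :* (con 0 :* d) :+ b :* con 0) ≈-refl (u (glue l [])) (v l) (u []) ⟩
        v l * (0# * u []) + v l * 0#
          ≈⟨ +-cong (*-congˡ (*-congʳ no-increasing)) (*-congˡ (ends-[] 0)) ⟨
        v l * increasing c [] + v l * ends 0 []        ∎
        where
        -- Since `1 ≤ c`, an empty right half cannot be 1 2 ⋯ c; hence the left half always carries
        -- the weight `v` rather than `u`.
        no-increasing : χ (≡-dec ℕₚ._≟_ [] (applyUpTo suc c)) ≈ 0#
        no-increasing = χ-no (≡-dec ℕₚ._≟_ [] (applyUpTo suc c)) λ eq →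
          contradiction 1≤c (ℕₚ.<⇒≱ (s≤s (ℕₚ.≤-reflexive (≡.sym (≡.trans (≡.cong length eq) (length-applyUpTo suc c))))))
      step (x ∷ r) vr = ≈-trans (*-congˡ (u-glue-∷ vl vr))
        (solve 4 (λ i e b d → (i :+ e) :* (b :* d) := b :* (i :* d) :+ b :* (e :* d)) ≈-refl _ _ (v l) (u (x ∷ r)))

    -- The maximum of 1 2 ⋯ (i+1) comes last, so the right half must be empty and the left half must
    -- be 1 2 ⋯ i.
    increasing-glue : ∀ i {l r} → Valid l → Valid r → increasing (suc i) (glue l r) ≈ increasing i l * empty r
    increasing-glue i {l} {r} vl vr = step r vr
      where
      I? : ∀ i w → Dec (red w ≡ applyUpTo suc i)
      I? i w = ≡-dec ℕₚ._≟_ (red w) (applyUpTo suc i)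
      split : ∀ {r} → Valid r → red (glue l r) ≡ applyUpTo suc (suc i) →
              map (length r ℕ.+_) (red (map (length r ℕ.+_) l)) ≡ applyUpTo suc i × red r ≡ []
      split vr eq = red-peak⁻ (glue-peak vl vr) (upTo-suc-peaked i) (≡.trans eq (≡.sym (applyUpTo-∷ʳ suc i)))
      step : ∀ r → Valid r → increasing (suc i) (glue l r) ≈ increasing i l * empty r
      step []      vr = ≈-trans (*-cong (χ-⇔ (I? (suc i) (glue l [])) (I? i l) to from) (u-glue-[] vl vr)) (≈-sym (*-identityʳ _))
        where
        to : red (glue l []) ≡ applyUpTo suc (suc i) → red l ≡ applyUpTo suc i
        to eq = ≡.trans (≡.sym (red-shift 0 l)) (≡.trans (≡.sym (map-id _)) (proj₁ (split vr eq)))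
        from : red l ≡ applyUpTo suc i → red (glue l []) ≡ applyUpTo suc (suc i)
        from eq = ≡.trans
          (red-peak⁺ (glue-peak vl vr) (upTo-suc-peaked i) (≡.trans (map-id _) (≡.trans (red-shift 0 l) eq)) refl) (applyUpTo-∷ʳ suc i)
      step (x ∷ r) vr = ≈-trans (*-congʳ (χ-no (I? (suc i) (glue l (x ∷ r))) λ eq → contradiction (proj₂ (split vr eq)) λ ()))
        (≈-trans (zeroˡ _) (≈-sym (zeroʳ _)))

    increasing-zero : ∀ w → increasing 0 w ≈ empty w
    increasing-zero []      = ≈-trans (*-identityˡ _) u-[]
    increasing-zero (x ∷ w) = zeroˡ _

    b C W Y : Series
    b = gf u
    C = gf nonempty
    W = gf v
    Y = constant y

    G : ℕ → Series
    G i = gf (ends i)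

    module Equations (1≤c : 1 ≤ c) = FunctionalEquation.Solution (PowerSeriesRing.commutativeRing P)
      𝕥 b C W Y (gf empty) (gf (λ _ → 0#)) G (λ i → gf (increasing i)) c j
      (λ f → fixed-point-unique f W)
      gf-empty gf-zero
      (λ n → ≈-trans (gf-cong u≈ n) (gf-+ empty nonempty n))
      (λ n → ≈-trans (gf-+ u (λ w → y * ends j w) n) (+-congˡ (gf-*ˡ y (ends j) n)))
      (gf-glue nonempty u empty v nonempty (zeroˡ _) nonempty-glue)
      (gf-cong increasing-zero)
      -- The second product is zero; it pads the recursion to the form of `gf-glue`.
      (λ i → gf-glue (increasing (suc i)) (increasing i) empty (λ _ → 0#) (λ _ → 0#) (zeroˡ _)
        (λ vl vr → ≈-trans (increasing-glue i vl vr) (≈-sym (≈-trans (+-congˡ (zeroˡ _)) (+-identityʳ _)))))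
      (gf-glue (ends 0) v (increasing c) v (ends 0) (ends-[] 0) (ends-zero-glue 1≤c))
      (λ i → gf-glue (ends (suc i)) (ends i) empty v (ends (suc i)) (ends-[] (suc i)) (ends-suc-glue i))

    open Exp 𝕊.semiring using () renaming (_^_ to _^ₛ_)

    -- The denominator is not the zero series.

    module _ (1≤c : 1 ≤ c) where
      open Equations 1≤c

      b₀≈1 : b 0 ≈ 1#
      b₀≈1 = ≈-trans (+-identityʳ _) u-[]

      b^₀≈1 : ∀ i → (b ^ₛ i) 0 ≈ 1#
      b^₀≈1 zero    = ≈-refl
      b^₀≈1 (suc i) = ≈-trans (+-identityʳ _) (≈-trans (*-cong b₀≈1 (b^₀≈1 i)) (*-identityˡ 1#))

      C₀≈0 : C 0 ≈ 0#
      C₀≈0 = ≈-trans (+-identityʳ _) (zeroˡ _)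

      C₁≈1 : C 1 ≈ 1#
      C₁≈1 = begin
        C 1                                           ≈⟨ C-equation 1 ⟩
        (𝕥 𝕊.* b) 1 + (𝕥 𝕊.* (W 𝕊.* C)) 1             ≈⟨ +-cong (𝕥-⊛-suc b 0) (𝕥-⊛-suc (W 𝕊.* C) 0) ⟩
        b 0 + (W 0 * C 0 + 0#)                        ≈⟨ +-cong b₀≈1 (+-congʳ (*-congˡ C₀≈0)) ⟩
        1# + (W 0 * 0# + 0#)                          ≈⟨ solve 1 (λ w → con 1 :+ (w :* con 0 :+ con 0) := con 1) ≈-refl (W 0) ⟩
        1#                                            ∎

      -- The series `b` minus 1 starts with t, and every power of `b` starts with 1, so their
      -- product starts with t.
      denominator₁≈1 : ∀ i → ((b 𝕊.+ (𝕊.- 𝕊.1#)) 𝕊.* b ^ₛ i) 1 ≈ 1#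
      denominator₁≈1 i = begin
        (b 0 + - 1#) * (b ^ₛ i) 1 + ((b 1 + - 0#) * (b ^ₛ i) 0 + 0#)
          ≈⟨ +-cong (*-congʳ (≈-trans (b-1≈C 0) C₀≈0)) (+-congʳ (*-cong (≈-trans (b-1≈C 1) C₁≈1) (b^₀≈1 i))) ⟩
        0# * (b ^ₛ i) 1 + (1# * 1# + 0#)
          ≈⟨ solve 1 (λ w → con 0 :* w :+ (con 1 :* con 1 :+ con 0) := con 1) ≈-refl ((b ^ₛ i) 1) ⟩
        1# ∎

      denominator≉0 : ¬ 1# ≈ 0# → ∀ i → ¬ ((b 𝕊.+ (𝕊.- 𝕊.1#)) 𝕊.* b ^ₛ i) 𝕊.≈ 𝕊.0#
      denominator≉0 1≉0 i den≈0 = 1≉0 (≈-trans (≈-sym (denominator₁≈1 i)) (den≈0 1))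

    Y≈x-1 : Y 𝕊.≈ (constant X 𝕊.+ (𝕊.- 𝕊.1#))
    Y≈x-1 zero    = ≈-refl
    Y≈x-1 (suc n) = ≈-sym (-‿inverseʳ 0#)

-- The identity over the rational numbers.

open import Defs
open Combinatorics using (δ; γ≡)
open ≡ using (refl)

ℚ[x]-ring : CommutativeRing _ _
ℚ[x]-ring = PolynomialRing.commutativeRing ℚₚ.+-*-commutativeRing

-- `π` and `k` are variables tied by equations, so that matching on `refl` puts the pattern and the
-- exponent m - a into their convenient forms throughout the statement at once.
fraction-identity : ∀ c j → 1 ≤ c → ∀ π k → π ≡ map suc (δ c j) ++ (3 ℕ.+ (c ℕ.+ j)) ∷ [ 1 ] → k ≡ suc j →
    let b   = B π
        num = t * b ^ (k ℕ.+ 2) + t ^ c * (x - 1#) * (b - 1# - t * b) * (b - 1#) ^ k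
        den = (b - 1#) * b ^ (k ∸ 1)
    in Σ[ den≉0 ∈ den ≉ 0# ] ι b ≃ num / den ⟨ den≉0 ⟩
fraction-identity c j 1≤c _ _ refl refl = denominator≉0 1≤c 1≉0 j , functional-equation x Y≈x-1
  where
  open GeneratingFunctions ℚ[x]-ring (x 0) using (module Weights)
  open Weights c j
  open Equations 1≤c using (functional-equation)
  open CommutativeRing ℚ[x]-ring using () renaming (_≈_ to _≈ₓ_; 1# to 1ₓ; 0# to 0ₓ)

  1≉0 : ¬ 1ₓ ≈ₓ 0ₓ
  1≉0 1≈0 with 1≈0 0
  ... | ()

theorem16 : (a m : ℕ) → 3 ≤ a → a ≤ m ∸ 1 →
    let b   = B (γ a m)
        num = t * b ^ (m ∸ a ℕ.+ 2) + t ^ (a ∸ 2) * (x - 1#) * (b - 1# - t * b) * (b - 1#) ^ (m ∸ a)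
        den = (b - 1#) * b ^ (m ∸ a ∸ 1)
    in Σ[ den≉0 ∈ den ≉ 0# ] ι b ≃ num / den ⟨ den≉0 ⟩
theorem16 (suc (suc (suc c))) (suc m) (s≤s (s≤s (s≤s _))) a≤m with ℕₚ.m≤n⇒∃[o]m+o≡n a≤m
-- Now a is `3 + c` and m is `4 + (c + j)`: the parameter a - 2 is `suc c`, and `j` is m - a - 1.
... | j , refl = fraction-identity (suc c) j (s≤s z≤n)
  (γ (3 ℕ.+ c) (4 ℕ.+ (c ℕ.+ j))) (4 ℕ.+ (c ℕ.+ j) ∸ (3 ℕ.+ c)) (γ≡ (suc c) j)
  (≡.trans (ℕₚ.+-∸-assoc 1 (ℕₚ.m≤m+n c j)) (≡.cong suc (ℕₚ.m+n∸m≡n c j)))
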